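{- For every $n,\lambda\in\mathbb{N}$ and each $\mu\in\{0,\dots,\lambda\}$, $$OP_{K_n,\operatorname{Aut}(K_n)}(\lambda,\mu)=\frac{1}{n!}\sum_{m=0}^{n}\binom{n}{m}\,Q_m(\lambda-\mu)\,P_{K_{n-m}}(\lambda,\mu),$$ where $Q_m(x)\in\mathbb{Z}[x]$ is defined by $$Q_m(x)=\sum_{k=0}^{m}\left[{m\atop k}\right]_2 x^k,$$ and $P_{K_{n-m}}(\lambda,\mu)$ is given by the formula $P_{K_r}(\lambda,\mu)=\sum_{k=0}^{r}\binom{r}{k}(\lambda-\mu)^k\mu^{\underline{r-k}}$ with $r=n-m$.
   Context: $\mathbb{N}$ denotes the positive integers. $K_n$ is the complete graph on $n$ vertices ($K_0$ is the empty graph), and $\operatorname{Aut}(\Gamma)$ is the automorphism group of a graph $\Gamma$, viewed as a group of permutations of the vertices. A $\lambda$-coloring of $\Gamma$ is a map $f$ from the vertex set of $\Gamma$ to $\{1,\dots,\lambda\}$; it is $\mu$-proper if for every pair of adjacent vertices $v,w$, either $f(v)\ne f(w)$ or $f(v)=f(w)>\mu$. $P_\Gamma(\lambda,\mu)$ is the number of $\mu$-proper $\lambda$-colorings of $\Gamma$. For a subgroup $G$ of $\operatorname{Aut}(\Gamma)$, $OP_{\Gamma,G}(\lambda,\mu)$ is the number of equivalence classes of $\mu$-proper $\lambda$-colorings of $\Gamma$, where $f$ and $f'$ are equivalent if $f'=f\circ g$ for some $g\in G$. $\left[{m\atop k}\right]_2$ denotes the 2-associated Stirling number of the first kind: the number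 of permutations of $m$ elements that decompose into exactly $k$ disjoint cycles, each of length at least $2$ (so $\left[{0\atop 0}\right]_2=1$). $x^{\underline{k}}=x(x-1)\cdots(x-k+1)$ is the falling factorial ($x^{\underline{0}}=1$), and $0^0=1$. -}

module Defs where

open import Data.Fin as Fin using (Fin; zero; suc; toℕ)
open import Data.Fin.Permutation as Perm
  using (Permutation′; _⟨$⟩ʳ_; _⟨$⟩ˡ_; _∘ₚ_; insert; remove)
import Data.Fin.Properties as Fin
open import Data.Integer as ℤ using (ℤ; +_; 0ℤ; 1ℤ)
open import Data.List as List
  using (List; []; _∷_; length; filter; deduplicate; allFin; upTo; cartesianProductWith)
open import Data.List.Membership.Propositional.Properties using (∈-allFin)
open import Data.List.Relation.Unary.Any as Any using (Any; here; any?)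
import Data.List.Relation.Unary.Any.Properties as Any
open import Data.Nat as ℕ using (ℕ; zero; suc; _+_; _∸_; _≤_; _<_)
open import Data.Nat.GeneralisedArithmetic using (fold; fold-+)
open import Data.Nat.Induction using (<-rec)
import Data.Nat.Properties as ℕ
open import Data.Product using (∃; ∃-syntax; _×_; _,_; proj₁; proj₂)
open import Data.Sum using (_⊎_)
import Data.Vec.Functional as Vector
open import Function using (_∘_; _⇔_; mk⇔; Equivalence; Injection)
open import Function.Properties.Inverse using (↔⇒↣)
open import Level using (0ℓ)
open import Relation.Binary as B
  using (Rel; Symmetric; Irreflexive; _Respects_; IsEquivalence; IsDecEquivalence)
open import Relation.Binary.PropositionalEquality
  using (_≡_; _≢_; _≗_; refl; sym; trans; cong; subst; subst₂)
open import Relation.Nullary using (Dec; yes; no)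
open import Relation.Nullary.Decidable using (map′; ¬?; _×-dec_; _⊎-dec_; _→-dec_)
open import Relation.Unary as U using (Pred)

-- The number of classes of a decidable equivalence relation that are
-- represented in a list.  Repetitions in the list are harmless, so a count is
-- meaningful as soon as the list is complete up to the relation.
#classes : ∀ {A : Set} {R : Rel A 0ℓ} → IsDecEquivalence R → List A → ℕ
#classes E xs = length (deduplicate (IsDecEquivalence._≟_ E) xs)

≈-isDecEquivalence : ∀ {n} → IsDecEquivalence (Perm._≈_ {n} {n})
≈-isDecEquivalence = record
  { isEquivalence = record
    { refl  = λ i → refl
    ; sym   = λ eq i → sym (eq i)
    ; trans = λ eq₁ eq₂ i → trans (eq₁ i) (eq₂ i)
    }
  ; _≟_ = λ π ρ → Fin.all? λ i → (π ⟨$⟩ʳ i) Fin.≟ (ρ ⟨$⟩ʳ i)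
  }

permutations : ∀ n → List (Permutation′ n)
permutations zero    = Perm.id ∷ []
permutations (suc n) = cartesianProductWith (insert zero) (allFin (suc n)) (permutations n)

permutations-complete : ∀ {n} (π : Permutation′ n) → Any (π Perm.≈_) (permutations n)
permutations-complete {zero}  π = here λ ()
permutations-complete {suc n} π =
  Any.cartesianProductWith⁺ (insert zero) step
    (∈-allFin (π ⟨$⟩ʳ zero)) (permutations-complete (remove zero π))
  where
  step : ∀ {j ρ} → π ⟨$⟩ʳ zero ≡ j → remove zero π Perm.≈ ρ → π Perm.≈ insert zero j ρ
  step refl eq zero    = refl
  step refl eq (suc i) = trans (Perm.punchIn-permute π zero i)
    (cong (Fin.punchIn (π ⟨$⟩ʳ zero)) (eq i))

anyPermutation? : ∀ {n} {P : Pred (Permutation′ n) 0ℓ} → P Respects Perm._≈_ →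
                  U.Decidable P → Dec (∃ P)
anyPermutation? resp P? = map′ Any.satisfied
  (λ (π , p) → Any.map (λ eq → resp eq p) (permutations-complete π))
  (any? P? (permutations _))

SameCycle : ∀ {n} → Permutation′ n → Rel (Fin n) 0ℓ
SameCycle π i j = ∃[ k ] fold i (π ⟨$⟩ʳ_) k ≡ j

module _ {n} (π : Permutation′ n) where

  private
    f : Fin n → Fin n
    f = π ⟨$⟩ʳ_

    cancel : ∀ k {i j} → fold i f k ≡ fold j f k → i ≡ j
    cancel zero    eq = eq
    cancel (suc k) eq = cancel k (Injection.injective (↔⇒↣ π) eq)

    period : ∀ i → ∃[ d ] suc d ≤ n × fold i f (suc d) ≡ i
    period i
      with a , b , a<b , eq ← Fin.pigeonhole (ℕ.n<1+n n) (λ k → fold i f (toℕ k))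
      with ℕ.m≤n⇒∃[o]m+o≡n a<b
    ... | d , 1+a+d≡b = d , d<n , cancel (toℕ a) (sym (trans eq
          (trans (cong (fold i f) (sym a+1+d≡b)) (fold-+ i f (toℕ a)))))
      where
      a+1+d≡b : toℕ a + suc d ≡ toℕ b
      a+1+d≡b = trans (ℕ.+-suc (toℕ a) d) 1+a+d≡b
      d<n : d < n
      d<n = ℕ.≤-trans (ℕ.m≤n+m (suc d) (toℕ a))
              (subst (_≤ n) (sym a+1+d≡b) (ℕ.s≤s⁻¹ (Fin.toℕ<n b)))

    reduce : ∀ i k → ∃[ l ] l < n × fold i f l ≡ fold i f k
    reduce i = <-rec _ go
      where
      go : ∀ k → (∀ {k′} → k′ < k → ∃[ l ] l < n × fold i f l ≡ fold i f k′) →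
           ∃[ l ] l < n × fold i f l ≡ fold i f k
      go k rec with k ℕ.<? n
      ... | yes k<n = k , k<n , refl
      ... | no  k≮n with d , d<n , per ← period i =
        let d<k         = ℕ.≤-trans d<n (ℕ.≮⇒≥ k≮n)
            l , l<n , eq = rec {k ∸ suc d} (ℕ.∸-monoʳ-< (ℕ.s≤s ℕ.z≤n) d<k)
        in l , l<n , trans eq (trans (cong (λ x → fold x f (k ∸ suc d)) (sym per))
             (trans (sym (fold-+ i f (k ∸ suc d))) (cong (fold i f) (ℕ.m∸n+n≡m d<k))))

    sc-trans : B.Transitive (SameCycle π)
    sc-trans {i} (k , refl) (l , refl) = l + k , fold-+ i f l

    back : ∀ i k → SameCycle π (fold i f k) i
    back i zero    = zero , refl
    back i (suc k) = sc-trans (step (fold i f k)) (back i k)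
      where
      step : ∀ j → SameCycle π (f j) j
      step j = let d , _ , per = period j in
        d , trans (sym (fold-+ j f d)) (trans (cong (fold j f) (ℕ.+-comm d 1)) per)

    sc-sym : B.Symmetric (SameCycle π)
    sc-sym {i} (k , refl) = back i k

  sameCycle-isDecEquivalence : IsDecEquivalence (SameCycle π)
  sameCycle-isDecEquivalence = record
    { isEquivalence = record
      { refl  = 0 , refl
      ; sym   = sc-sym
      ; trans = sc-trans
      }
    ; _≟_ = λ i j → map′
        (λ (k , _ , eq) → k , eq)
        (λ (k , eq) → let l , l<n , eq′ = reduce i k in l , l<n , trans eq′ eq)
        (ℕ.anyUpTo? (λ k → fold i f k Fin.≟ j) n)
    }

  #cycles : ℕ
  #cycles = #classes sameCycle-isDecEquivalence (allFin n)

  cycleLength : Fin n → ℕ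
  cycleLength i = length (filter (IsDecEquivalence._≟_ sameCycle-isDecEquivalence i) (allFin n))

AssociatedCycles : ∀ d {m} → ℕ → Pred (Permutation′ m) 0ℓ
AssociatedCycles d k π = #cycles π ≡ k × (∀ i → d ≤ cycleLength π i)

associatedCycles? : ∀ d {m} k → U.Decidable (AssociatedCycles d {m} k)
associatedCycles? d k π = (#cycles π ℕ.≟ k) ×-dec Fin.all? (λ i → d ℕ.≤? cycleLength π i)

-- d-associated Stirling numbers of the first kind.
associatedStirling₁ : ℕ → ℕ → ℕ → ℕ
associatedStirling₁ d m k =
  #classes ≈-isDecEquivalence (filter (associatedCycles? d k) (permutations m))

record Graph (n : ℕ) : Set₁ where
  field
    Adj    : Rel (Fin n) 0ℓ
    adj?   : B.Decidable Adj
    symm   : Symmetric Adj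
    irrefl : Irreflexive _≡_ Adj

K : ∀ n → Graph n
K n = record
  { Adj    = _≢_
  ; adj?   = λ v w → ¬? (v Fin.≟ w)
  ; symm   = λ v≢w w≡v → v≢w (sym w≡v)
  ; irrefl = λ v≡w v≢w → v≢w v≡w
  }

module _ {n} (Γ : Graph n) where
  open Graph Γ

  IsAutomorphism : Pred (Permutation′ n) 0ℓ
  IsAutomorphism π = ∀ v w → Adj v w ⇔ Adj (π ⟨$⟩ʳ v) (π ⟨$⟩ʳ w)

  record AutSubgroup : Set₁ where
    field
      Member    : Pred (Permutation′ n) 0ℓ
      member?   : U.Decidable Member
      resp      : Member Respects Perm._≈_
      id-closed : Member Perm.id
      ∘-closed  : ∀ {π ρ} → Member π → Member ρ → Member (π ∘ₚ ρ)
      ⁻¹-closed : ∀ {π} → Member π → Member (Perm.flip π)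
      auto      : ∀ {π} → Member π → IsAutomorphism π

  Aut : AutSubgroup
  Aut = record
    { Member    = IsAutomorphism
    ; member?   = λ π → Fin.all? λ v → Fin.all? λ w →
        map′ (λ (to , from) → mk⇔ to from) (λ e → Equivalence.to e , Equivalence.from e)
          ((adj? v w →-dec adj? (π ⟨$⟩ʳ v) (π ⟨$⟩ʳ w)) ×-dec
           (adj? (π ⟨$⟩ʳ v) (π ⟨$⟩ʳ w) →-dec adj? v w))
    ; resp      = λ eq a v w → mk⇔
        (subst₂ Adj (eq v) (eq w) ∘ Equivalence.to (a v w))
        (Equivalence.from (a v w) ∘ subst₂ Adj (sym (eq v)) (sym (eq w)))
    ; id-closed = λ v w → mk⇔ (λ p → p) (λ p → p)
    ; ∘-closed  = λ {π} a b v w → mk⇔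
        (Equivalence.to (b (π ⟨$⟩ʳ v) (π ⟨$⟩ʳ w)) ∘ Equivalence.to (a v w))
        (Equivalence.from (a v w) ∘ Equivalence.from (b (π ⟨$⟩ʳ v) (π ⟨$⟩ʳ w)))
    ; ⁻¹-closed = λ {π} a v w → mk⇔
        (Equivalence.from (a (π ⟨$⟩ˡ v) (π ⟨$⟩ˡ w)) ∘
          subst₂ Adj (sym (Perm.inverseʳ π)) (sym (Perm.inverseʳ π)))
        (subst₂ Adj (Perm.inverseʳ π) (Perm.inverseʳ π) ∘
          Equivalence.to (a (π ⟨$⟩ˡ v) (π ⟨$⟩ˡ w)))
    ; auto      = λ a → a
    }

Coloring : ℕ → ℕ → Set
Coloring n ℓ = Fin n → Fin ℓ

-- The colors are 1, …, ℓ, so the element c of Fin ℓ stands for 1 + c.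
color : ∀ {ℓ} → Fin ℓ → ℕ
color c = suc (toℕ c)

≗-isDecEquivalence : ∀ {n ℓ} → IsDecEquivalence {A = Coloring n ℓ} _≗_
≗-isDecEquivalence = record
  { isEquivalence = record
    { refl  = λ v → refl
    ; sym   = λ eq v → sym (eq v)
    ; trans = λ eq₁ eq₂ v → trans (eq₁ v) (eq₂ v)
    }
  ; _≟_ = λ f g → Fin.all? λ v → f v Fin.≟ g v
  }

colorings : ∀ n ℓ → List (Coloring n ℓ)
colorings zero    ℓ = Vector.[] ∷ []
colorings (suc n) ℓ = cartesianProductWith Vector._∷_ (allFin ℓ) (colorings n ℓ)

colorings-complete : ∀ {n ℓ} (f : Coloring n ℓ) → Any (f ≗_) (colorings n ℓ)
colorings-complete {zero}  f = here λ ()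
colorings-complete {suc n} f =
  Any.cartesianProductWith⁺ Vector._∷_
    (λ { eq eqs zero → eq ; eq eqs (suc v) → eqs v })
    (∈-allFin (f zero)) (colorings-complete (f ∘ suc))

module _ {n} (Γ : Graph n) where
  open Graph Γ

  Proper : ∀ {ℓ} → ℕ → Pred (Coloring n ℓ) 0ℓ
  Proper μ f = ∀ v w → Adj v w → f v ≢ f w ⊎ (f v ≡ f w × μ < color (f v))

  proper? : ∀ {ℓ} μ → U.Decidable (Proper {ℓ} μ)
  proper? μ f = Fin.all? λ v → Fin.all? λ w → adj? v w →-dec
    (¬? (f v Fin.≟ f w) ⊎-dec ((f v Fin.≟ f w) ×-dec (μ ℕ.<? color (f v))))

  properColorings : ∀ ℓ → ℕ → List (Coloring n ℓ)
  properColorings ℓ μ = filter (proper? μ) (colorings n ℓ)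

  P : ℕ → ℕ → ℕ
  P ℓ μ = #classes ≗-isDecEquivalence (properColorings ℓ μ)

  module _ (G : AutSubgroup Γ) where
    open AutSubgroup G

    Equivalent : ∀ {ℓ} → Rel (Coloring n ℓ) 0ℓ
    Equivalent f f′ = ∃[ g ] Member g × f′ ≗ f ∘ (g ⟨$⟩ʳ_)

    equivalent-isDecEquivalence : ∀ {ℓ} → IsDecEquivalence (Equivalent {ℓ})
    equivalent-isDecEquivalence = record
      { isEquivalence = record
        { refl  = Perm.id , id-closed , λ v → refl
        ; sym   = λ {f} (g , g∈G , eq) → Perm.flip g , ⁻¹-closed g∈G , λ v →
            sym (trans (eq (g ⟨$⟩ˡ v)) (cong f (Perm.inverseʳ g)))
        ; trans = λ (g , g∈G , eq) (h , h∈G , eq′) →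
            h ∘ₚ g , ∘-closed h∈G g∈G , λ v → trans (eq′ v) (eq (h ⟨$⟩ʳ v))
        }
      ; _≟_ = λ f f′ → anyPermutation?
          (λ g≈h (g∈G , eq) → resp g≈h g∈G , λ v → trans (eq v) (cong f (g≈h v)))
          (λ g → member? g ×-dec Fin.all? λ v → f′ v Fin.≟ f (g ⟨$⟩ʳ v))
      }

    OP : ℕ → ℕ → ℕ
    OP ℓ μ = #classes equivalent-isDecEquivalence (properColorings ℓ μ)

sumTo : ℕ → (ℕ → ℤ) → ℤ
sumTo zero    f = f 0
sumTo (suc n) f = sumTo n f ℤ.+ f (suc n)

_^↓_ : ℤ → ℕ → ℤ
x ^↓ zero  = 1ℤ
x ^↓ suc k = (x ^↓ k) ℤ.* (x ℤ.- + k)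

-- Coefficient lists, constant term first.
ℤ[x] : Set
ℤ[x] = List ℤ

eval : ℤ[x] → ℤ → ℤ
eval []      x = 0ℤ
eval (a ∷ p) x = a ℤ.+ x ℤ.* eval p x

Q : ℕ → ℤ[x]
Q m = List.map (λ k → + associatedStirling₁ 2 m k) (upTo (suc m))

{-# OPTIONS --safe #-}

-- With x = λ − μ, both sides are read as exponential generating functions in n.
-- A single-use color occurs at most once in a proper coloring, and removing its
-- vertex shows that raising μ by one (x fixed) multiplies the generating functions
-- of P and of n! OP by 1 + t.  So it suffices to treat μ = 0, where P_r = xʳ and
-- n! OP is the rising factorial x(x+1)⋯(x+n−1).  There the claim says that
-- T = q eˣᵗ, with q the generating function of the Q_m, satisfies (1 − t) T′ = x T;
-- this follows from (1 − t) q′ = x t q, the recurrence of the associated Stirling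
-- numbers obtained by deleting one element from a derangement.
module Submission where

open import Defs
open import Algebra.Properties.CommutativeSemigroup using (interchange; x∙yz≈y∙xz)
open import Data.Empty using (⊥-elim)
open import Data.Fin as Fin using (Fin; zero; suc; toℕ; punchIn; punchOut)
open import Data.Fin.Permutation as Perm
  using (Permutation′; _⟨$⟩ʳ_; _⟨$⟩ˡ_; _∘ₚ_; _≈_; insert; remove; lift₀; transpose)
import Data.Fin.Permutation.Components as PC
import Data.Fin.Properties as Fin
open import Data.Integer using (ℤ; 0ℤ; 1ℤ)
open import Data.Integer using (+_; _+_; _-_; _*_; _^_)
import Data.Integer.Properties as ℤ
open import Data.Integer.Tactic.RingSolver using (solve-∀)
open import Data.List
  using (List; []; _∷_; length; lookup; map; filter; deduplicate; allFin; applyUpTo)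
open import Data.List.Membership.Propositional using (_∈_)
open import Data.List.Membership.Propositional.Properties
  using (∈-allFin; ∈-lookup; ∈-filter⁺; ∈-filter⁻)
open import Data.List.Relation.Unary.All as All using (All; []; _∷_)
import Data.List.Relation.Unary.All.Properties as All
open import Data.List.Relation.Unary.AllPairs using (AllPairs; []; _∷_)
open import Data.List.Relation.Unary.Any as Any using (Any; here; there)
import Data.List.Relation.Unary.Any.Properties as Any
open import Data.List.Relation.Unary.Unique.DecSetoid.Properties using (deduplicate-!)
open import Data.List.Relation.Unary.Unique.Propositional using (Unique)
import Data.List.Relation.Unary.Unique.Propositional.Properties as Unique
open import Data.Nat as ℕ using (zero; suc; _<_; z≤n; s≤s)
open import Data.Nat using (ℕ; NonZero; _≤_; _∸_; _!)
open import Data.Nat.Combinatorics using (_C_)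
open import Data.Nat.Combinatorics using (nCk+nC[k+1]≡[n+1]C[k+1]; k>n⇒nCk≡0)
open import Data.Nat.GeneralisedArithmetic using (fold)
import Data.Nat.Properties as ℕ
open import Data.Nat.Properties using (_!≢0)
open import Data.Product using (∃; _,_; proj₁; proj₂; map₂)
open import Data.Product using (_×_)
open import Data.Rational using (_/_)
import Data.Rational.Properties as ℚ
open import Data.Rational.Unnormalised using (mkℚᵘ; *≡*)
open import Data.Sum using (_⊎_; inj₁; inj₂; [_,_]′)
open import Data.Sum.Function.Propositional using (_⊎-↔_)
open import Data.Unit using (⊤; tt)
import Data.Vec.Functional as Vector
import Data.Vec.Functional.Properties as Vector
open import Function using (_∘_; id; _⇔_; mk⇔; _↔_; Inverse; Equivalence; Injection)
open import Function.Construct.Composition using (_↔-∘_)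
open import Function.Construct.Identity using (↔-id)
open import Function.Construct.Symmetry using (↔-sym)
open import Function.Properties.Inverse using (↔⇒↣)
open import Level using (0ℓ)
open import Relation.Binary using (Rel; Symmetric; IsEquivalence; IsDecEquivalence)
open import Relation.Binary.PropositionalEquality using (_≡_)
open import Relation.Binary.PropositionalEquality
  using (_≢_; _≗_; refl; sym; trans; cong; cong₂; subst; subst₂; ≢-sym; module ≡-Reasoning)
open import Relation.Nullary using (¬_; yes; no; contradiction)
open import Relation.Nullary.Decidable using (dec-true; dec-false; toSum)
open import Relation.Unary as U using (Pred)
open ≡-Reasoning

-- In closed form q is (e⁻ᵗ/(1 - t))ˣ and T is (1 - t)⁻ˣ: for μ = 0, q corrects the count xⁿ of
-- colorings to n! times the count of multisets of n colors out of x. Since every permutation is an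
-- automorphism of `K n`, orbits are enumerated directly, by the same case distinction on the color
-- `zero` as the colorings. Colors live in `Fin (μ + x)` with the single-use ones in front, so
-- `zero` is single-use as long as μ is positive, and discarding it is the inverse of `suc`. The
-- counts in the statement are lengths of deduplicated lists of functions or permutations, which are
-- compared only pointwise or up to an equivalence. Each count is therefore determined by a
-- transversal indexed by `Fin k`, with k given by a recurrence; only the recurrences enter the
-- algebra.

-- Sequences as exponential generating functions

private
  +-interchange = interchange ℤ.+-commutativeSemigroup
  +-leftCommute = x∙yz≈y∙xz ℤ.+-commutativeSemigroup
  *-leftCommute = x∙yz≈y∙xz ℤ.*-commutativeSemigroup

Sequence : Set
Sequence = ℕ → ℤ

infixl 7 _⊛_

-- The product of exponential generating functions, by (FG)′ = F′G + FG′;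
-- differentiation is the shift.
_⊛_ : Sequence → Sequence → Sequence
(F ⊛ G) zero    = F 0 * G 0
(F ⊛ G) (suc n) = (F ∘ suc ⊛ G) n + (F ⊛ G ∘ suc) n

-- Multiplication of an exponential generating function by its variable.
t· : Sequence → Sequence
t· F zero    = 0ℤ
t· F (suc n) = + suc n * F n

⊛-cong : ∀ {F F′ G G′} → F ≗ F′ → G ≗ G′ → F ⊛ G ≗ F′ ⊛ G′
⊛-cong p q zero    = cong₂ _*_ (p 0) (q 0)
⊛-cong p q (suc n) = cong₂ _+_ (⊛-cong (p ∘ suc) q n) (⊛-cong p (q ∘ suc) n)

⊛-comm : ∀ F G → F ⊛ G ≗ G ⊛ F
⊛-comm F G zero    = ℤ.*-comm (F 0) (G 0)
⊛-comm F G (suc n) = trans (ℤ.+-comm ((F ∘ suc ⊛ G) n) _)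
  (cong₂ _+_ (⊛-comm F (G ∘ suc) n) (⊛-comm (F ∘ suc) G n))

⊛-distribˡ-+ : ∀ F G H → F ⊛ (λ n → G n + H n) ≗ λ n → (F ⊛ G) n + (F ⊛ H) n
⊛-distribˡ-+ F G H zero    = ℤ.*-distribˡ-+ (F 0) (G 0) (H 0)
⊛-distribˡ-+ F G H (suc n) = trans
  (cong₂ _+_ (⊛-distribˡ-+ (F ∘ suc) G H n) (⊛-distribˡ-+ F (G ∘ suc) (H ∘ suc) n))
  (+-interchange ((F ∘ suc ⊛ G) n) ((F ∘ suc ⊛ H) n) ((F ⊛ G ∘ suc) n) _)

⊛-scaleʳ : ∀ c F G → F ⊛ (λ n → c * G n) ≗ λ n → c * (F ⊛ G) n
⊛-scaleʳ c F G zero    = *-leftCommute (F 0) c (G 0)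
⊛-scaleʳ c F G (suc n) = trans
  (cong₂ _+_ (⊛-scaleʳ c (F ∘ suc) G n) (⊛-scaleʳ c F (G ∘ suc) n))
  (sym (ℤ.*-distribˡ-+ c _ _))

-- The product rule (tF)′ = F + tF′.
t·-suc : ∀ F n → t· F (suc n) ≡ F n + t· (F ∘ suc) n
t·-suc F zero    = unit (F 0)
  where
  unit : ∀ a → 1ℤ * a ≡ a + 0ℤ
  unit = solve-∀
t·-suc F (suc n) = expand (+ suc n) (F (suc n))
  where
  expand : ∀ k a → (1ℤ + k) * a ≡ a + k * a
  expand = solve-∀

t·-cong : ∀ {F G} → F ≗ G → t· F ≗ t· G
t·-cong p zero    = refl
t·-cong p (suc n) = cong (+ suc n *_) (p n)

t·-+ : ∀ F G → t· (λ n → F n + G n) ≗ λ n → t· F n + t· G n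
t·-+ F G zero    = refl
t·-+ F G (suc n) = ℤ.*-distribˡ-+ (+ suc n) (F n) (G n)

⊛-t· : ∀ F G → F ⊛ t· G ≗ t· (F ⊛ G)
⊛-t· F G zero    = ℤ.*-zeroʳ (F 0)
⊛-t· F G (suc n) = begin
  (F ∘ suc ⊛ t· G) n + (F ⊛ t· G ∘ suc) n
    ≡⟨ cong₂ _+_ (⊛-t· (F ∘ suc) G n) (⊛-cong {F = F} (λ _ → refl) (t·-suc G) n) ⟩
  t· (F ∘ suc ⊛ G) n + (F ⊛ (λ k → G k + t· (G ∘ suc) k)) n
    ≡⟨ cong (_+_ (t· (F ∘ suc ⊛ G) n)) (⊛-distribˡ-+ F G _ n) ⟩
  t· (F ∘ suc ⊛ G) n + ((F ⊛ G) n + (F ⊛ t· (G ∘ suc)) n)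
    ≡⟨ cong (λ z → t· (F ∘ suc ⊛ G) n + ((F ⊛ G) n + z)) (⊛-t· F (G ∘ suc) n) ⟩
  t· (F ∘ suc ⊛ G) n + ((F ⊛ G) n + t· (F ⊛ G ∘ suc) n)
    ≡⟨ +-leftCommute (t· (F ∘ suc ⊛ G) n) ((F ⊛ G) n) _ ⟩
  (F ⊛ G) n + (t· (F ∘ suc ⊛ G) n + t· (F ⊛ G ∘ suc) n)
    ≡⟨ cong (_+_ ((F ⊛ G) n)) (t·-+ (F ∘ suc ⊛ G) (F ⊛ G ∘ suc) n) ⟨
  (F ⊛ G) n + t· ((F ⊛ G) ∘ suc) n
    ≡⟨ t·-suc (F ⊛ G) n ⟨
  t· (F ⊛ G) (suc n) ∎

-- The step from μ to μ + 1 in a product whose first factor does not involve μ. It serves for P,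
-- with G the falling factorials, and for n! OP, with G the sequence of P.
⊛-[1+t] : ∀ F {G G₁} → (∀ n → G₁ n ≡ G n + t· G n) →
          ∀ n → (F ⊛ G₁) n ≡ (F ⊛ G) n + t· (F ⊛ G) n
⊛-[1+t] F {G} {G₁} eq n = begin
  (F ⊛ G₁) n                    ≡⟨ ⊛-cong {F = F} (λ _ → refl) eq n ⟩
  (F ⊛ (λ k → G k + t· G k)) n  ≡⟨ ⊛-distribˡ-+ F G (t· G) n ⟩
  (F ⊛ G) n + (F ⊛ t· G) n      ≡⟨ cong (_+_ ((F ⊛ G) n)) (⊛-t· F G n) ⟩
  (F ⊛ G) n + t· (F ⊛ G) n      ∎

⊛-zeroʳ : ∀ F {G} → (∀ n → G n ≡ 0ℤ) → ∀ n → (F ⊛ G) n ≡ 0ℤ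
⊛-zeroʳ F z zero    = trans (cong (F 0 *_) (z 0)) (ℤ.*-zeroʳ (F 0))
⊛-zeroʳ F z (suc n) = cong₂ _+_ (⊛-zeroʳ (F ∘ suc) z n) (⊛-zeroʳ F (z ∘ suc) n)

-- Finite sums

sumTo-cong : ∀ n {f g} → (∀ k → k ≤ n → f k ≡ g k) → sumTo n f ≡ sumTo n g
sumTo-cong zero    eq = eq 0 z≤n
sumTo-cong (suc n) eq =
  cong₂ _+_ (sumTo-cong n (λ k k≤n → eq k (ℕ.m≤n⇒m≤1+n k≤n))) (eq (suc n) ℕ.≤-refl)

sumTo-suc : ∀ n f → sumTo (suc n) f ≡ f 0 + sumTo n (f ∘ suc)
sumTo-suc zero    f = refl
sumTo-suc (suc n) f = trans (cong (_+ f (suc (suc n))) (sumTo-suc n f)) (ℤ.+-assoc (f 0) _ _)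

sumTo-+ : ∀ n f g → sumTo n (λ k → f k + g k) ≡ sumTo n f + sumTo n g
sumTo-+ zero    f g = refl
sumTo-+ (suc n) f g = trans (cong (_+ (f (suc n) + g (suc n))) (sumTo-+ n f g))
  (+-interchange (sumTo n f) (sumTo n g) (f (suc n)) (g (suc n)))

sumTo-*ˡ : ∀ n c f → sumTo n (λ k → c * f k) ≡ c * sumTo n f
sumTo-*ˡ zero    c f = refl
sumTo-*ˡ (suc n) c f = trans (cong (_+ c * f (suc n)) (sumTo-*ˡ n c f))
  (sym (ℤ.*-distribˡ-+ c (sumTo n f) (f (suc n))))

-- Pascal's rule is the Leibniz rule: of the two parts of `suc n C suc m`, the first belongs to F′G
-- and the second to FG′.
binomialSum : ∀ n F G → sumTo n (λ m → + (n C m) * F m * G (n ∸ m)) ≡ (F ⊛ G) n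
binomialSum zero    F G = cong (_* G 0) (ℤ.*-identityˡ (F 0))
binomialSum (suc n) F G = begin
  sumTo (suc n) (term (suc n) F G)
    ≡⟨ sumTo-suc n _ ⟩
  a₀ + sumTo n (λ m → + (suc n C suc m) * F (suc m) * G (n ∸ m))
    ≡⟨ cong (_+_ a₀) (sumTo-cong n λ m _ → trans
         (cong (λ c → + c * F (suc m) * G (n ∸ m)) (sym (nCk+nC[k+1]≡[n+1]C[k+1] n m)))
         (split (+ (n C m)) (+ (n C suc m)) (F (suc m)) (G (n ∸ m)))) ⟩
  a₀ + sumTo n (λ m → term n (F ∘ suc) G m + b m)
    ≡⟨ cong (_+_ a₀) (sumTo-+ n (term n (F ∘ suc) G) b) ⟩
  a₀ + (sumTo n (term n (F ∘ suc) G) + sumTo n b)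
    ≡⟨ +-leftCommute a₀ (sumTo n (term n (F ∘ suc) G)) (sumTo n b) ⟩
  sumTo n (term n (F ∘ suc) G) + (a₀ + sumTo n b)
    ≡⟨ cong₂ _+_ (binomialSum n (F ∘ suc) G) rest ⟩
  (F ∘ suc ⊛ G) n + (F ⊛ G ∘ suc) n ∎
  where
  term : ℕ → Sequence → Sequence → ℕ → ℤ
  term n F G m = + (n C m) * F m * G (n ∸ m)
  a₀ = term (suc n) F G 0
  b : ℕ → ℤ
  b m = + (n C suc m) * F (suc m) * G (n ∸ m)
  split : ∀ c d u v → (c + d) * u * v ≡ c * u * v + d * u * v
  split = solve-∀
  c : ℕ → ℤ
  c m = + (n C m) * F m * G (suc n ∸ m)
  -- The term `a₀`, to which Pascal's rule does not apply, supplies the missing term 0 of FG′; the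
  -- excess term at `suc n` carries the coefficient `n C suc n`, which is 0.
  rest : a₀ + sumTo n b ≡ (F ⊛ G ∘ suc) n
  rest = begin
    a₀ + sumTo n b
      ≡⟨ sumTo-suc n c ⟨
    sumTo n c + c (suc n)
      ≡⟨ cong (λ z → sumTo n c + + z * F (suc n) * G (n ∸ n)) (k>n⇒nCk≡0 (ℕ.n<1+n n)) ⟩
    sumTo n c + 0ℤ * F (suc n) * G (n ∸ n)
      ≡⟨ ℤ.+-identityʳ _ ⟩
    sumTo n c
      ≡⟨ sumTo-cong n (λ m m≤n → cong (λ k → + (n C m) * F m * G k) (ℕ.+-∸-assoc 1 m≤n)) ⟩
    sumTo n (term n F (G ∘ suc))
      ≡⟨ binomialSum n F (G ∘ suc) ⟩
    (F ⊛ G ∘ suc) n ∎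

-- Falling and rising factorials

-- The falling factorials of y have generating function (1 + t)^y.
^↓-[1+t] : ∀ y n → (1ℤ + y) ^↓ n ≡ y ^↓ n + t· (y ^↓_) n
^↓-[1+t] y zero          = refl
^↓-[1+t] y (suc zero)    = base y
  where
  base : ∀ y → 1ℤ * (1ℤ + y - 0ℤ) ≡ 1ℤ * (y - 0ℤ) + 1ℤ * 1ℤ
  base = solve-∀
^↓-[1+t] y (suc (suc k)) = trans
  (cong (_* (1ℤ + y - + suc k)) (^↓-[1+t] y (suc k)))
  (step y (+ k) (y ^↓ k))
  where
  step : ∀ y k a → (a * (y - k) + (1ℤ + k) * a) * (1ℤ + y - (1ℤ + k))
                 ≡ a * (y - k) * (y - (1ℤ + k)) + (1ℤ + (1ℤ + k)) * (a * (y - k))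
  step = solve-∀

0^↓suc : ∀ k → 0ℤ ^↓ suc k ≡ 0ℤ
0^↓suc zero    = refl
0^↓suc (suc k) = cong (_* (0ℤ - + suc k)) (0^↓suc k)

-- The falling factorials of 0 are 1, 0, 0, ..., the unit of the product; this is the case μ = 0 of
-- `#proper-formula`.
⊛-0^↓ : ∀ F n → (F ⊛ (0ℤ ^↓_)) n ≡ F n
⊛-0^↓ F zero    = ℤ.*-identityʳ (F 0)
⊛-0^↓ F (suc n) = trans (cong₂ _+_ (⊛-0^↓ (F ∘ suc) n) (⊛-zeroʳ F 0^↓suc n)) (ℤ.+-identityʳ _)

_^↑_ : ℤ → ℕ → ℤ
x ^↑ zero  = 1ℤ
x ^↑ suc k = (x ^↑ k) * (x + + k)

-- The rising factorials of x have generating function (1 - t)⁻ˣ, and the identity says that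
-- multiplying the one for x + 1 by 1 - t gives the one for x.
^↑-suc : ∀ x n → (1ℤ + x) ^↑ suc n ≡ x ^↑ suc n + + suc n * (1ℤ + x) ^↑ n
^↑-suc x n = trans (expand x (+ n) ((1ℤ + x) ^↑ n)) (cong (_+ + suc n * (1ℤ + x) ^↑ n) (shift n))
  where
  expand : ∀ x n a → a * (1ℤ + x + n) ≡ x * a + (1ℤ + n) * a
  expand = solve-∀
  shift : ∀ n → x * (1ℤ + x) ^↑ n ≡ x ^↑ suc n
  shift zero    = unit x
    where
    unit : ∀ x → x * 1ℤ ≡ 1ℤ * (x + 0ℤ)
    unit = solve-∀
  shift (suc n) = trans (assoc x ((1ℤ + x) ^↑ n) (+ n)) (cong (_* (x + + suc n)) (shift n))
    where
    assoc : ∀ x a n → x * (a * (1ℤ + x + n)) ≡ x * a * (x + (1ℤ + n))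
    assoc = solve-∀

0^↑suc : ∀ k → 0ℤ ^↑ suc k ≡ 0ℤ
0^↑suc zero    = refl
0^↑suc (suc k) = cong (_* + suc k) (0^↑suc k)

-- q satisfies (1 - t) q′ = x t q, whence T = q eˣᵗ satisfies (1 - t) T′ = x T.
⊛-^≡^↑ : ∀ x q → q 0 ≡ 1ℤ → (∀ n → q (suc n) ≡ t· (q ∘ suc) n + x * t· q n) →
         ∀ n → (q ⊛ (x ^_)) n ≡ x ^↑ n
⊛-^≡^↑ x q q₀ q′ = go
  where
  X T q⁺ : Sequence
  X = x ^_
  T = q ⊛ X
  q⁺ = q ∘ suc
  left : ∀ F G n → ((λ k → t· F k + x * t· G k) ⊛ X) n ≡ t· (F ⊛ X) n + x * t· (G ⊛ X) n
  left F G n = begin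
    ((λ k → t· F k + x * t· G k) ⊛ X) n
      ≡⟨ ⊛-comm _ X n ⟩
    (X ⊛ (λ k → t· F k + x * t· G k)) n
      ≡⟨ ⊛-distribˡ-+ X (t· F) _ n ⟩
    (X ⊛ t· F) n + (X ⊛ (λ k → x * t· G k)) n
      ≡⟨ cong (_+_ ((X ⊛ t· F) n)) (⊛-scaleʳ x X (t· G) n) ⟩
    (X ⊛ t· F) n + x * (X ⊛ t· G) n
      ≡⟨ cong₂ (λ u v → u + x * v) (⊛-t· X F n) (⊛-t· X G n) ⟩
    t· (X ⊛ F) n + x * t· (X ⊛ G) n
      ≡⟨ cong₂ (λ u v → u + x * v) (t·-cong (⊛-comm X F) n) (t·-cong (⊛-comm X G) n) ⟩
    t· (F ⊛ X) n + x * t· (G ⊛ X) n ∎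
  right : ∀ n → (q ⊛ X ∘ suc) n ≡ x * T n
  right = ⊛-scaleʳ x q X
  T′ : ∀ n → T (suc n) ≡ t· (q⁺ ⊛ X) n + x * t· T n + x * T n
  T′ n = cong₂ _+_ (trans (⊛-cong {G = X} q′ (λ _ → refl) n) (left q⁺ q n)) (right n)
  -- By `right` the left side is t(q′X + qX′) = tT′, with coefficients n Tₙ. Hence Tₙ₊₁ = (x + n)
  -- Tₙ, the recurrence of the rising factorial.
  tT′ : ∀ n → t· (q⁺ ⊛ X) n + x * t· T n ≡ + n * T n
  tT′ zero    = trans (ℤ.+-identityˡ _) (ℤ.*-zeroʳ x)
  tT′ (suc n) = trans (collect (+ suc n) ((q⁺ ⊛ X) n) x (T n))
    (cong (λ z → + suc n * ((q⁺ ⊛ X) n + z)) (sym (right n)))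
    where
    collect : ∀ k a x b → k * a + x * (k * b) ≡ k * (a + x * b)
    collect = solve-∀
  go : ∀ n → T n ≡ x ^↑ n
  go zero    = cong (_* 1ℤ) q₀
  go (suc n) = begin
    T (suc n)            ≡⟨ trans (T′ n) (cong (_+ x * T n) (tT′ n)) ⟩
    + n * T n + x * T n  ≡⟨ factor (+ n) x (T n) ⟩
    T n * (x + + n)      ≡⟨ cong (_* (x + + n)) (go n) ⟩
    x ^↑ suc n           ∎
    where
    factor : ∀ n x a → n * a + x * a ≡ a * (x + n)
    factor = solve-∀

-- Recurrences for the numbers of colorings, of orbits and of derangements

-- For `suc μ` the summands are the colorings without the color `zero` and those with it; the factor
-- `suc n` is the choice of its only vertex.
#proper : ℕ → ℕ → ℕ → ℕ
#proper zero    x n       = x ℕ.^ n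
#proper (suc μ) x zero    = #proper μ x zero
#proper (suc μ) x (suc n) = #proper μ x (suc n) ℕ.+ suc n ℕ.* #proper μ x n

-- The same split, without the factor `suc n` because vertices are interchangeable. At μ = 0 these
-- are the multiset coefficients: `zero` may recur, so x is kept in the second summand.
#orbits : ℕ → ℕ → ℕ → ℕ
#orbits zero    x       zero    = 1
#orbits zero    zero    (suc n) = 0
#orbits zero    (suc x) (suc n) = #orbits zero x (suc n) ℕ.+ #orbits zero (suc x) n
#orbits (suc μ) x       zero    = #orbits μ x zero
#orbits (suc μ) x       (suc n) = #orbits μ x (suc n) ℕ.+ #orbits μ x n

-- The factors `suc m` are the choices of the predecessor of the deleted element; the second summand
-- is the case where the two form a 2-cycle.
#derangements : ℕ → ℕ → ℕ
#derangements zero          zero    = 1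
#derangements zero          (suc k) = 0
#derangements (suc m)       zero    = 0
#derangements (suc zero)    (suc k) = 0
#derangements (suc (suc m)) (suc k) =
  suc m ℕ.* #derangements (suc m) (suc k) ℕ.+ suc m ℕ.* #derangements m k

+◃^ : ∀ x n → + (x ℕ.^ n) ≡ (+ x) ^ n
+◃^ x zero    = refl
+◃^ x (suc n) = trans (ℤ.pos-* x (x ℕ.^ n)) (cong (+ x *_) (+◃^ x n))

#proper-[1+t] : ∀ μ x n →
  + #proper (suc μ) x n ≡ + #proper μ x n + t· (λ k → + #proper μ x k) n
#proper-[1+t] μ x zero    = sym (ℤ.+-identityʳ _)
#proper-[1+t] μ x (suc n) = cong (_+_ (+ #proper μ x (suc n))) (ℤ.pos-* (suc n) (#proper μ x n))

#proper-formula : ∀ μ x n → + #proper μ x n ≡ (((+ x) ^_) ⊛ ((+ μ) ^↓_)) n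
#proper-formula zero    x n = trans (+◃^ x n) (sym (⊛-0^↓ ((+ x) ^_) n))
#proper-formula (suc μ) x n = begin
  + #proper (suc μ) x n
    ≡⟨ #proper-[1+t] μ x n ⟩
  + #proper μ x n + t· (λ k → + #proper μ x k) n
    ≡⟨ cong₂ _+_ (#proper-formula μ x n) (t·-cong (#proper-formula μ x) n) ⟩
  (X ⊛ ((+ μ) ^↓_)) n + t· (X ⊛ ((+ μ) ^↓_)) n
    ≡⟨ ⊛-[1+t] X (^↓-[1+t] (+ μ)) n ⟨
  (X ⊛ ((+ suc μ) ^↓_)) n ∎
  where X = (+ x) ^_

n!#orbits : ℕ → ℕ → Sequence
n!#orbits μ x n = + (n ! ℕ.* #orbits μ x n)

n!#orbits-suc : ∀ n a b →
  + (suc n ! ℕ.* (a ℕ.+ b)) ≡ + (suc n ! ℕ.* a) + + suc n * + (n ! ℕ.* b)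
n!#orbits-suc n a b = begin
  + (suc n ! ℕ.* (a ℕ.+ b))                  ≡⟨ cong +_ (ℕ.*-distribˡ-+ (suc n !) a b) ⟩
  + (suc n ! ℕ.* a) + + (suc n ! ℕ.* b)      ≡⟨ cong (λ z → + (suc n ! ℕ.* a) + + z) (ℕ.*-assoc (suc n) (n !) b) ⟩
  + (suc n ! ℕ.* a) + + (suc n ℕ.* (n ! ℕ.* b)) ≡⟨ cong (_+_ (+ (suc n ! ℕ.* a))) (ℤ.pos-* (suc n) (n ! ℕ.* b)) ⟩
  + (suc n ! ℕ.* a) + + suc n * + (n ! ℕ.* b) ∎

n!#orbits-[1+t] : ∀ μ x n → n!#orbits (suc μ) x n ≡ n!#orbits μ x n + t· (n!#orbits μ x) n
n!#orbits-[1+t] μ x zero    = sym (ℤ.+-identityʳ _)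
n!#orbits-[1+t] μ x (suc n) = n!#orbits-suc n (#orbits μ x (suc n)) (#orbits μ x n)

n!#orbits₀ : ∀ x n → n!#orbits 0 x n ≡ (+ x) ^↑ n
n!#orbits₀ x       zero    = refl
n!#orbits₀ zero    (suc n) = trans (cong +_ (ℕ.*-zeroʳ (suc n !))) (sym (0^↑suc n))
n!#orbits₀ (suc x) (suc n) = begin
  n!#orbits 0 (suc x) (suc n)
    ≡⟨ n!#orbits-suc n (#orbits 0 x (suc n)) (#orbits 0 (suc x) n) ⟩
  n!#orbits 0 x (suc n) + + suc n * n!#orbits 0 (suc x) n
    ≡⟨ cong₂ (λ u v → u + + suc n * v) (n!#orbits₀ x (suc n)) (n!#orbits₀ (suc x) n) ⟩
  (+ x) ^↑ suc n + + suc n * (+ suc x) ^↑ n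
    ≡⟨ ^↑-suc (+ x) n ⟨
  (+ suc x) ^↑ suc n ∎

-- Every further single-use color multiplies both sides by 1 + t, so one q serves all μ, and the
-- hypothesis on q is the case μ = 0.
n!#orbits-formula : ∀ q μ x → (∀ n → (q ⊛ ((+ x) ^_)) n ≡ (+ x) ^↑ n) →
  ∀ n → n!#orbits μ x n ≡ (q ⊛ (λ k → + #proper μ x k)) n
n!#orbits-formula q zero    x h n = begin
  n!#orbits 0 x n             ≡⟨ n!#orbits₀ x n ⟩
  (+ x) ^↑ n                  ≡⟨ h n ⟨
  (q ⊛ ((+ x) ^_)) n          ≡⟨ ⊛-cong {F = q} (λ _ → refl) (+◃^ x) n ⟨
  (q ⊛ (λ k → + (x ℕ.^ k))) n ∎
n!#orbits-formula q (suc μ) x h n = begin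
  n!#orbits (suc μ) x n
    ≡⟨ n!#orbits-[1+t] μ x n ⟩
  n!#orbits μ x n + t· (n!#orbits μ x) n
    ≡⟨ cong₂ _+_ (n!#orbits-formula q μ x h n) (t·-cong (n!#orbits-formula q μ x h) n) ⟩
  (q ⊛ p) n + t· (q ⊛ p) n
    ≡⟨ ⊛-[1+t] q (#proper-[1+t] μ x) n ⟨
  (q ⊛ (λ k → + #proper (suc μ) x k)) n ∎
  where
  p : Sequence
  p k = + #proper μ x k

-- The polynomials Q

-- Stated for every g because `applyUpTo` recurses by replacing g with `g ∘ suc`, in step with
-- Horner's scheme.
eval-map-applyUpTo : ∀ (h : ℕ → ℤ) x m g →
  eval (map h (applyUpTo g (suc m))) x ≡ sumTo m (λ k → h (g k) * x ^ k)
eval-map-applyUpTo h x zero    g = unit (h (g 0)) x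
  where
  unit : ∀ a x → a + x * 0ℤ ≡ a * 1ℤ
  unit = solve-∀
eval-map-applyUpTo h x (suc m) g = begin
  h (g 0) + x * eval (map h (applyUpTo (g ∘ suc) (suc m))) x
    ≡⟨ cong (λ z → h (g 0) + x * z) (eval-map-applyUpTo h x m (g ∘ suc)) ⟩
  h (g 0) + x * sumTo m (λ k → h (g (suc k)) * x ^ k)
    ≡⟨ cong₂ _+_ (sym (ℤ.*-identityʳ (h (g 0)))) (sym (sumTo-*ˡ m x _)) ⟩
  h (g 0) * 1ℤ + sumTo m (λ k → x * (h (g (suc k)) * x ^ k))
    ≡⟨ cong (_+_ (h (g 0) * 1ℤ)) (sumTo-cong m λ k _ → *-leftCommute x (h (g (suc k))) (x ^ k)) ⟩
  h (g 0) * 1ℤ + sumTo m (λ k → h (g (suc k)) * x ^ suc k)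
    ≡⟨ sumTo-suc m (λ k → h (g k) * x ^ k) ⟨
  sumTo (suc m) (λ k → h (g k) * x ^ k) ∎

-- Allows the polynomials of different m to be summed over a common range of k.
#derangements-zero : ∀ m k → m < k → #derangements m k ≡ 0
#derangements-zero zero          (suc k) _         = refl
#derangements-zero (suc zero)    (suc k) _         = refl
#derangements-zero (suc (suc m)) (suc k) (s≤s m<k) = cong₂ ℕ._+_
  (trans (cong (suc m ℕ.*_) (#derangements-zero (suc m) (suc k) (ℕ.m≤n⇒m≤1+n m<k))) (ℕ.*-zeroʳ (suc m)))
  (trans (cong (suc m ℕ.*_) (#derangements-zero m k (ℕ.<-trans (ℕ.n<1+n m) m<k))) (ℕ.*-zeroʳ (suc m)))

module _ (x : ℤ) where

  term : ℕ → ℕ → ℤ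
  term m k = + #derangements m k * x ^ k

  derangementPoly : Sequence
  derangementPoly m = sumTo m (term m)

  private
    extend : ∀ m N → m ≤ N → sumTo (suc N) (term m) ≡ sumTo N (term m)
    extend m N m≤N = trans
      (cong (λ z → sumTo N (term m) + + z * x ^ suc N) (#derangements-zero m (suc N) (s≤s m≤N)))
      (ℤ.+-identityʳ _)

    drop₀ : ∀ m N → sumTo (suc N) (term (suc m)) ≡ sumTo N (term (suc m) ∘ suc)
    drop₀ m N = trans (sumTo-suc N (term (suc m))) (ℤ.+-identityˡ _)

  -- Multiply the recurrence of `#derangements` by x^(k+1) and sum over k; there is no term at k =
  -- 0, as a nonempty permutation has a cycle.
  derangementPoly-rec : ∀ n →
    derangementPoly (suc n) ≡ t· (derangementPoly ∘ suc) n + x * t· derangementPoly n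
  derangementPoly-rec zero    = sym (trans (ℤ.+-identityˡ _) (ℤ.*-zeroʳ x))
  derangementPoly-rec (suc m) = begin
    sumTo (suc (suc m)) (term (suc (suc m)))
      ≡⟨ drop₀ (suc m) (suc m) ⟩
    sumTo (suc m) (term (suc (suc m)) ∘ suc)
      ≡⟨ sumTo-cong (suc m) (λ k _ → step k) ⟩
    sumTo (suc m) (λ k → + suc m * term (suc m) (suc k) + + suc m * x * term m k)
      ≡⟨ sumTo-+ (suc m) _ _ ⟩
    sumTo (suc m) (λ k → + suc m * term (suc m) (suc k)) + sumTo (suc m) (λ k → + suc m * x * term m k)
      ≡⟨ cong₂ _+_ (sumTo-*ˡ (suc m) (+ suc m) (term (suc m) ∘ suc)) (sumTo-*ˡ (suc m) (+ suc m * x) (term m)) ⟩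
    + suc m * sumTo (suc m) (term (suc m) ∘ suc) + + suc m * x * sumTo (suc m) (term m)
      ≡⟨ cong₂ (λ u v → + suc m * u + + suc m * x * v)
           (trans (sym (drop₀ m (suc m))) (extend (suc m) (suc m) ℕ.≤-refl))
           (extend m m ℕ.≤-refl) ⟩
    + suc m * derangementPoly (suc m) + + suc m * x * derangementPoly m
      ≡⟨ cong (_+_ (+ suc m * derangementPoly (suc m))) (swap (+ suc m) x (derangementPoly m)) ⟩
    + suc m * derangementPoly (suc m) + x * (+ suc m * derangementPoly m) ∎
    where
    swap : ∀ a b c → a * b * c ≡ b * (a * c)
    swap = solve-∀
    regroup : ∀ c a b x y → (c * a + c * b) * (x * y) ≡ c * (a * (x * y)) + c * x * (b * y)
    regroup = solve-∀
    step : ∀ k → term (suc (suc m)) (suc k) ≡ + suc m * term (suc m) (suc k) + + suc m * x * term m k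
    step k = trans
      (cong (_* x ^ suc k) (cong₂ _+_ (ℤ.pos-* (suc m) (#derangements (suc m) (suc k)))
                                      (ℤ.pos-* (suc m) (#derangements m k))))
      (regroup (+ suc m) (+ #derangements (suc m) (suc k)) (+ #derangements m k) x (x ^ k))

-- Both fractions normalise unnormalised ones, for which equality is cross-multiplication; matching
-- on `suc d` fits the denominator-minus-one encoding of `mkℚᵘ`.
/-cancel : ∀ d .{{_ : NonZero d}} a {s} → s ≡ + d * a → a / 1 ≡ s / d
/-cancel (suc d) a {s} eq = ℚ.fromℚᵘ-cong {mkℚᵘ a 0} {mkℚᵘ s d}
  (*≡* (trans (ℤ.*-comm a (+ suc d)) (trans (sym eq) (sym (ℤ.*-identityʳ s)))))

-- Transversals

-- One representative in Φ for each R-class meeting Φ. Elements are located only up to R, so no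
-- function extensionality is called for, and sums and products of index types mirror the
-- recurrences.
record Transversal {A : Set} (R : Rel A 0ℓ) (Φ : Pred A 0ℓ) (I : Set) : Set where
  field
    rep           : I → A
    rep-injective : ∀ {i j} → R (rep i) (rep j) → i ≡ j
    rep-sound     : ∀ i → Φ (rep i)
    index         : ∀ {x} → Φ x → ∃ λ i → R x (rep i)

open Transversal

private
  variable
    A I J : Set
    R S : Rel A 0ℓ
    Φ Ψ : Pred A 0ℓ
    n : ℕ

reindex : I ↔ J → Transversal R Φ I → Transversal R Φ J
reindex {R = R} e T = record
  { rep           = rep T ∘ Inverse.from e
  ; rep-injective = λ r → Injection.injective (↔⇒↣ (↔-sym e)) (rep-injective T r)
  ; rep-sound     = rep-sound T ∘ Inverse.from e
  ; index         = λ p → let i , r = index T p in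
      Inverse.to e i , subst (λ z → R _ (rep T z)) (sym (Inverse.strictlyInverseʳ e i)) r
  }

transversal-cong : (∀ {x y} → R x y ⇔ S x y) → (∀ {x} → Φ x ⇔ Ψ x) →
                   Transversal R Φ I → Transversal S Ψ I
transversal-cong r p T = record
  { rep           = rep T
  ; rep-injective = rep-injective T ∘ Equivalence.from r
  ; rep-sound     = Equivalence.to p ∘ rep-sound T
  ; index         = map₂ (Equivalence.to r) ∘ index T ∘ Equivalence.from p
  }

transversal-≤ : IsEquivalence R → ∀ {k l} →
                Transversal R Φ (Fin k) → Transversal R Φ (Fin l) → k ≤ l
transversal-≤ {R = R} equiv {k} {l} T T′ = Fin.injective⇒≤ {f = proj₁ ∘ move} injective
  where
  open IsEquivalence equiv renaming (sym to R-sym; trans to R-trans)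
  move : ∀ i → ∃ λ j → R (rep T i) (rep T′ j)
  move i = index T′ (rep-sound T i)
  injective : ∀ {i j} → proj₁ (move i) ≡ proj₁ (move j) → i ≡ j
  injective {i} {j} eq = rep-injective T (R-trans (proj₂ (move i))
    (R-sym (subst (λ z → R (rep T j) (rep T′ z)) (sym eq) (proj₂ (move j)))))

lookup-injective : Symmetric R → ∀ {xs : List A} → AllPairs (λ x y → ¬ R x y) xs →
                   ∀ {i j} → R (lookup xs i) (lookup xs j) → i ≡ j
lookup-injective R-sym (_ ∷ _)  {zero}  {zero}  _ = refl
lookup-injective R-sym (x ∷ _)  {zero}  {suc j} r = contradiction r (All.lookup x (∈-lookup j))
lookup-injective R-sym (x ∷ _)  {suc i} {zero}  r = contradiction (R-sym r) (All.lookup x (∈-lookup i))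
lookup-injective R-sym (_ ∷ xs) {suc i} {suc j} r = cong suc (lookup-injective R-sym xs r)

unique-⊆⇒length≤ : ∀ {xs ys : List A} → Unique xs → (∀ {x} → x ∈ xs → x ∈ ys) →
                   length xs ≤ length ys
unique-⊆⇒length≤ {xs = xs} {ys} xs! xs⊆ys = Fin.injective⇒≤ {f = f} λ {i} {j} eq →
  lookup-injective sym xs! (trans (f-lookup i) (trans (cong (lookup ys) eq) (sym (f-lookup j))))
  where
  f : Fin (length xs) → Fin (length ys)
  f i = Any.index (xs⊆ys (∈-lookup {xs = xs} i))
  f-lookup : ∀ i → lookup xs i ≡ lookup ys (f i)
  f-lookup i = Any.lookup-index (xs⊆ys (∈-lookup {xs = xs} i))

module _ {A : Set} {R : Rel A 0ℓ} (E : IsDecEquivalence R) where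
  open IsDecEquivalence E using (isEquivalence; _≟_) renaming (sym to R-sym; trans to R-trans)

  classes : ∀ {Φ xs} → All Φ xs → (∀ {x} → Φ x → Any (R x) xs) →
            Transversal R Φ (Fin (#classes E xs))
  classes {xs = xs} sound complete = record
    { rep           = lookup ys
    ; rep-injective = lookup-injective R-sym (deduplicate-! (record { isDecEquivalence = E }) xs)
    ; rep-sound     = λ i → All.lookup (All.deduplicate⁺ _≟_ sound) (∈-lookup i)
    ; index         = λ p →
        let q = Any.deduplicate⁺ _≟_ (λ b~a x~a → R-trans x~a (R-sym b~a)) (complete p)
        in Any.index q , Any.lookup-index q
    }
    where ys = deduplicate _≟_ xs

  #classes-≡ : ∀ {Φ xs k} → All Φ xs → (∀ {x} → Φ x → Any (R x) xs) →
               Transversal R Φ (Fin k) → #classes E xs ≡ k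
  #classes-≡ sound complete T = ℕ.≤-antisym
    (transversal-≤ isEquivalence (classes sound complete) T)
    (transversal-≤ isEquivalence T (classes sound complete))

  -- Two relations occur because the enumerations are complete up to pointwise equality S, while the
  -- classes are those of a possibly coarser R.
  #classes-filter : ∀ {S : Rel A 0ℓ} {Φ} (Φ? : U.Decidable Φ) {xs k} →
    (∀ {x y} → S x y → R x y) → (∀ {x y} → S x y → Φ x → Φ y) → (∀ x → Any (S x) xs) →
    Transversal R Φ (Fin k) → #classes E (filter Φ? xs) ≡ k
  #classes-filter Φ? {xs} S⇒R resp complete = #classes-≡ {xs = filter Φ? xs} (All.all-filter Φ? xs) λ {x} p →
    Any.map S⇒R ([ id , (λ ¬q → contradiction (resp (Any.lookup-result (complete x)) p) ¬q) ]′
                 (Any.filter⁺ Φ? (complete x)))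

-- Colorings of complete graphs

punchView : ∀ (i j : Fin (suc n)) → i ≡ j ⊎ ∃ λ k → punchIn i k ≡ j
punchView i j with i Fin.≟ j
... | yes i≡j = inj₁ i≡j
... | no  i≢j = inj₂ (punchOut i≢j , Fin.punchIn-punchOut i≢j)

-- The color of c is `suc (toℕ c)`, so μ < color becomes μ ≤ `toℕ`: the single-use colors are the
-- first μ elements of `Fin ℓ`.
ProperK : ∀ {n ℓ} → ℕ → Pred (Coloring n ℓ) 0ℓ
ProperK μ f = ∀ {v w} → f v ≡ f w → v ≢ w → μ ≤ toℕ (f v)

ProperK⇔Proper : ∀ {n ℓ μ} {f : Coloring n ℓ} → ProperK μ f ⇔ Proper (K n) μ f
ProperK⇔Proper {n} {ℓ} {μ} {f} = mk⇔ to from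
  where
  to : ProperK μ f → Proper (K n) μ f
  to p v w v≢w with f v Fin.≟ f w
  ... | yes eq = inj₂ (eq , s≤s (p eq v≢w))
  ... | no neq = inj₁ neq
  from : Proper (K n) μ f → ProperK μ f
  from p {v} {w} eq v≢w with p v w v≢w
  ... | inj₁ neq             = contradiction eq neq
  ... | inj₂ (_ , s≤s μ≤fv) = μ≤fv

Avoids₀ : ∀ {n ℓ} → Pred (Coloring n (suc ℓ)) 0ℓ
Avoids₀ f = ∀ v → f v ≢ zero

avoids₀⇒suc : ∀ {n ℓ} {f : Coloring n (suc ℓ)} → Avoids₀ f → ∃ λ g → ∀ v → f v ≡ suc (g v)
avoids₀⇒suc nz = (λ v → punchOut (≢-sym (nz v))) , λ v → sym (Fin.punchIn-punchOut (≢-sym (nz v)))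

ProperK-suc⁺ : ∀ {n ℓ μ} {g : Coloring n ℓ} → ProperK μ g → ProperK (suc μ) (suc ∘ g)
ProperK-suc⁺ p eq v≢w = s≤s (p (Fin.suc-injective eq) v≢w)

ProperK-suc⁻ : ∀ {n ℓ μ} {f : Coloring n (suc ℓ)} {g} → (∀ v → f v ≡ suc (g v)) →
               ProperK (suc μ) f → ProperK μ g
ProperK-suc⁻ f≗ p {v} {w} eq v≢w
  with s≤s μ≤ ← subst (λ c → _ ≤ toℕ c) (f≗ v)
                  (p (trans (f≗ v) (trans (cong suc eq) (sym (f≗ w)))) v≢w) = μ≤

-- What remains of a proper coloring without a vertex of the single-use color zero.
ProperAvoiding₀ : ∀ {n ℓ} → ℕ → Pred (Coloring n (suc ℓ)) 0ℓ
ProperAvoiding₀ μ f = ProperK (suc μ) f × Avoids₀ f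

module _ {n ℓ μ : ℕ} {f : Coloring (suc n) (suc ℓ)} {v : Fin (suc n)} (fv≡0 : f v ≡ zero) where

  ProperK-punchIn⁺ : ProperAvoiding₀ μ (f ∘ punchIn v) → ProperK (suc μ) f
  ProperK-punchIn⁺ (p , nz) {a} {b} eq a≢b with punchView v a | punchView v b
  ... | inj₁ refl       | inj₁ refl       = contradiction refl a≢b
  ... | inj₁ refl       | inj₂ (w , refl) = contradiction (trans (sym eq) fv≡0) (nz w)
  ... | inj₂ (w , refl) | inj₁ refl       = contradiction (trans eq fv≡0) (nz w)
  ... | inj₂ (w , refl) | inj₂ (_ , refl) = p eq (a≢b ∘ cong (punchIn v))

  ProperK-punchIn⁻ : ProperK (suc μ) f → ProperAvoiding₀ μ (f ∘ punchIn v)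
  ProperK-punchIn⁻ p = (λ eq w≢w′ → p eq (w≢w′ ∘ Fin.punchIn-injective v _ _)) , nz
    where
    nz : Avoids₀ (f ∘ punchIn v)
    nz w eq with () ← subst (λ c → suc μ ≤ toℕ c) eq
                        (p (trans eq (sym fv≡0)) (Fin.punchInᵢ≢i v w))

-- Colorings that avoid `zero` are colorings with one single-use color fewer. R and S are left
-- abstract so that this covers both equality of colorings and orbits.
shift : ∀ {n ℓ μ} {R : Rel (Coloring n ℓ) 0ℓ} {S : Rel (Coloring n (suc ℓ)) 0ℓ} →
  (∀ {g g′} → S (suc ∘ g) (suc ∘ g′) → R g g′) →
  (∀ {f g g′} → (∀ v → f v ≡ suc (g v)) → R g g′ → S f (suc ∘ g′)) →
  Transversal R (ProperK μ) I → Transversal S (ProperAvoiding₀ μ) I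
shift S⇒R R⇒S T = record
  { rep           = λ i → suc ∘ rep T i
  ; rep-injective = rep-injective T ∘ S⇒R
  ; rep-sound     = λ i → ProperK-suc⁺ (rep-sound T i) , λ v ()
  ; index         = λ (p , nz) → let g , f≗ = avoids₀⇒suc nz in
      map₂ (R⇒S f≗) (index T (ProperK-suc⁻ f≗ p))
  }

≗-suc⁻ : ∀ {n ℓ} {g g′ : Coloring n ℓ} → suc ∘ g ≗ suc ∘ g′ → g ≗ g′
≗-suc⁻ eq v = Fin.suc-injective (eq v)

≗-suc⁺ : ∀ {n ℓ} {f : Coloring n (suc ℓ)} {g g′} → (∀ v → f v ≡ suc (g v)) → g ≗ g′ → f ≗ suc ∘ g′
≗-suc⁺ f≗ eq v = trans (f≗ v) (cong suc (eq v))

funToFin-cong : ∀ {m n} {f g : Fin m → Fin n} → f ≗ g → Fin.funToFin f ≡ Fin.funToFin g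
funToFin-cong {zero}  eq = refl
funToFin-cong {suc m} eq = cong₂ Fin.combine (eq zero) (funToFin-cong (eq ∘ suc))

-- As the remaining vertices avoid `zero`, the vertex v carrying it can be read off from the
-- coloring; hence distinct pairs (v , j) give distinct colorings.
properColorings-step : ∀ {n ℓ μ} →
  Transversal _≗_ (ProperAvoiding₀ {suc n} {ℓ} μ) I →
  Transversal _≗_ (ProperAvoiding₀ {n} {ℓ} μ) J →
  Transversal _≗_ (ProperK (suc μ)) (I ⊎ (Fin (suc n) × J))
properColorings-step {I} {J} {n} {ℓ} {μ} T T′ = record
  { rep           = r
  ; rep-injective = λ {i} {j} → injective i j
  ; rep-sound     = sound
  ; index         = λ {f} p → ix f p
  }
  where
  r : I ⊎ (Fin (suc n) × J) → Coloring (suc n) (suc ℓ)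
  r (inj₁ i)       = rep T i
  r (inj₂ (v , j)) = Vector.insertAt (rep T′ j) v zero
  r-at : ∀ v j → r (inj₂ (v , j)) v ≡ zero
  r-at v j = Vector.insertAt-lookup (rep T′ j) v zero
  r-punchIn : ∀ v j w → r (inj₂ (v , j)) (punchIn v w) ≡ rep T′ j w
  r-punchIn v j = Vector.insertAt-punchIn (rep T′ j) v zero
  only : ∀ v j w → r (inj₂ (v , j)) w ≡ zero → v ≡ w
  only v j w eq with punchView v w
  ... | inj₁ v≡w       = v≡w
  ... | inj₂ (u , refl) = contradiction (trans (sym (r-punchIn v j u)) eq) (proj₂ (rep-sound T′ j) u)
  injective : ∀ i j → r i ≗ r j → i ≡ j
  injective (inj₁ i) (inj₁ j) eq = cong inj₁ (rep-injective T eq)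
  injective (inj₁ i) (inj₂ (v , j)) eq =
    contradiction (trans (eq v) (r-at v j)) (proj₂ (rep-sound T i) v)
  injective (inj₂ (v , i)) (inj₁ j) eq =
    contradiction (trans (sym (eq v)) (r-at v i)) (proj₂ (rep-sound T j) v)
  injective (inj₂ (v , i)) (inj₂ (w , j)) eq with refl ← only v i w (trans (eq w) (r-at w j)) =
    cong (λ z → inj₂ (v , z)) (rep-injective T′ λ u →
      trans (sym (r-punchIn v i u)) (trans (eq (punchIn v u)) (r-punchIn v j u)))
  sound : ∀ i → ProperK (suc μ) (r i)
  sound (inj₁ i)       = proj₁ (rep-sound T i)
  sound (inj₂ (v , j)) = ProperK-punchIn⁺ (r-at v j)
    ( (λ {w} {w′} eq w≢w′ → subst (λ c → suc μ ≤ toℕ c) (sym (r-punchIn v j w))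
        (p (trans (sym (r-punchIn v j w)) (trans eq (r-punchIn v j w′))) w≢w′))
    , λ w eq → nz w (trans (sym (r-punchIn v j w)) eq))
    where
    p  = λ {v} {w} → proj₁ (rep-sound T′ j) {v} {w}
    nz = proj₂ (rep-sound T′ j)
  ix : ∀ f → ProperK (suc μ) f → ∃ λ i → f ≗ r i
  ix f p with Fin.any? (λ v → f v Fin.≟ zero)
  ... | no ¬z = let i , eq = index T ((λ {v} {w} → p {v} {w}) , λ v z → ¬z (v , z)) in inj₁ i , eq
  ... | yes (v , z) = let j , eq = index T′ (ProperK-punchIn⁻ z p) in inj₂ (v , j) , agree j eq
    where
    agree : ∀ j → f ∘ punchIn v ≗ rep T′ j → f ≗ r (inj₂ (v , j))
    agree j eq w with punchView v w
    ... | inj₁ refl       = trans z (sym (r-at v j))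
    ... | inj₂ (u , refl) = trans (eq u) (sym (r-punchIn v j u))

properColorings-transversal : ∀ μ x n →
  Transversal _≗_ (ProperK {n} {μ ℕ.+ x} μ) (Fin (#proper μ x n))
properColorings-transversal zero x n = record
  { rep           = Fin.finToFun
  ; rep-injective = λ {i} {j} eq → trans (sym (Fin.funToFin-finToFin {n} i))
      (trans (funToFin-cong eq) (Fin.funToFin-finToFin {n} j))
  ; rep-sound     = λ _ _ _ → z≤n
  ; index         = λ {f} _ → Fin.funToFin f , λ v → sym (Fin.finToFun-funToFin f v)
  }
-- The empty coloring is the only one; just the index set is inherited from μ.
properColorings-transversal (suc μ) x zero = record
  { rep           = λ _ ()
  ; rep-injective = λ _ → rep-injective T λ ()
  ; rep-sound     = λ _ {v} → λ _ _ → ⊥-elim (Fin.¬Fin0 v)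
  ; index         = λ _ → proj₁ (index T {λ ()} λ {v} → ⊥-elim (Fin.¬Fin0 v)) , λ ()
  }
  where T = properColorings-transversal μ x zero
properColorings-transversal (suc μ) x (suc n) =
  reindex (↔-sym ((↔-id _ ⊎-↔ Fin.*↔×) ↔-∘ Fin.+↔⊎))
    (properColorings-step (shift ≗-suc⁻ ≗-suc⁺ (properColorings-transversal μ x (suc n)))
                          (shift ≗-suc⁻ ≗-suc⁺ (properColorings-transversal μ x n)))

≗-Proper : ∀ {n ℓ μ} {f g : Coloring n ℓ} → f ≗ g → Proper (K n) μ f → Proper (K n) μ g
≗-Proper {μ = μ} eq p v w v≢w =
  subst₂ (λ c d → c ≢ d ⊎ (c ≡ d × μ < color c)) (eq v) (eq w) (p v w v≢w)

P-formula : ∀ {μ x ℓ} → μ ℕ.+ x ≡ ℓ → ∀ n → P (K n) ℓ μ ≡ #proper μ x n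
P-formula {μ} {x} refl n = #classes-filter ≗-isDecEquivalence (proper? (K n) μ)
  id ≗-Proper colorings-complete
  (transversal-cong (mk⇔ id id) ProperK⇔Proper (properColorings-transversal μ x n))

-- Orbits of colorings

infix 4 _∼_

-- Membership in `Aut (K n)` is dropped: a permutation is injective, hence preserves and reflects
-- distinctness of vertices.
record _∼_ {n ℓ} (f f′ : Coloring n ℓ) : Set where
  constructor _,_
  field
    permutation : Permutation′ n
    recolors    : f′ ≗ f ∘ (permutation ⟨$⟩ʳ_)

∼⇔Equivalent : ∀ {n ℓ} {f f′ : Coloring n ℓ} → f ∼ f′ ⇔ Equivalent (K n) (Aut (K n)) f f′
∼⇔Equivalent = mk⇔
  (λ (π , eq) → π , (λ v w → mk⇔ (λ v≢w → v≢w ∘ Injection.injective (↔⇒↣ π)) (_∘ cong (π ⟨$⟩ʳ_))) , eq)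
  (λ (π , _ , eq) → π , eq)

transpose-atˡ : ∀ {n} (i j : Fin n) → PC.transpose i j i ≡ j
transpose-atˡ i j rewrite dec-true (i Fin.≟ i) refl = refl

∘-transpose : ∀ {n} {A : Set} (f : Fin n → A) {i j} → f i ≡ f j → f ∘ PC.transpose i j ≗ f
∘-transpose f {i} {j} eq k with k Fin.≟ i
... | yes refl = sym eq
... | no _ with k Fin.≟ j
...   | yes refl = eq
...   | no _     = refl

-- A transposition of two vertices of the color of zero makes π fix zero.
∼-tail : ∀ {n ℓ} {f f′ : Coloring (suc n) ℓ} → f zero ≡ f′ zero → f ∼ f′ → f ∘ suc ∼ f′ ∘ suc
∼-tail {f = f} {f′} eq₀ (π , eq) = remove zero σ , λ v → begin
  f′ (suc v)                       ≡⟨ eq (suc v) ⟩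
  f (π ⟨$⟩ʳ suc v)                 ≡⟨ ∘-transpose f fa≡f0 (π ⟨$⟩ʳ suc v) ⟨
  f (σ ⟨$⟩ʳ suc v)                 ≡⟨ cong f (Perm.lift₀-remove σ (transpose-atˡ a zero) (suc v)) ⟨
  f (suc (remove zero σ ⟨$⟩ʳ v))   ∎
  where
  a = π ⟨$⟩ʳ zero
  σ = π ∘ₚ transpose a zero
  fa≡f0 : f a ≡ f zero
  fa≡f0 = trans (sym (eq zero)) (sym eq₀)

∼-suc⁻ : ∀ {n ℓ} {g g′ : Coloring n ℓ} → suc ∘ g ∼ suc ∘ g′ → g ∼ g′
∼-suc⁻ (π , eq) = π , λ v → Fin.suc-injective (eq v)

∼-suc⁺ : ∀ {n ℓ} {f : Coloring n (suc ℓ)} {g g′} →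
         (∀ v → f v ≡ suc (g v)) → g ∼ g′ → f ∼ suc ∘ g′
∼-suc⁺ f≗ (π , eq) = π , λ v → trans (cong suc (eq v)) (sym (f≗ (π ⟨$⟩ʳ v)))

-- Either the color zero does not occur, or a vertex of color zero can be moved to the front.
orbits-step : ∀ {n ℓ} {Φ : Pred (Coloring (suc n) (suc ℓ)) 0ℓ} {Ψ : Pred (Coloring n (suc ℓ)) 0ℓ} →
  (∀ {g} → Ψ g → Φ (zero Vector.∷ g)) →
  (∀ {f v} → f v ≡ zero → Φ f → Ψ (f ∘ punchIn v)) →
  Transversal _∼_ (λ f → Φ f × Avoids₀ f) I → Transversal _∼_ Ψ J →
  Transversal _∼_ Φ (I ⊎ J)
orbits-step {I} {J} {n} {ℓ} {Φ} {Ψ} cons delete T T′ = record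
  { rep           = r
  ; rep-injective = λ {i} {j} → injective i j
  ; rep-sound     = λ { (inj₁ i) → proj₁ (rep-sound T i) ; (inj₂ j) → cons (rep-sound T′ j) }
  ; index         = λ {f} → ix f
  }
  where
  r : I ⊎ J → Coloring (suc n) (suc ℓ)
  r (inj₁ i) = rep T i
  r (inj₂ j) = zero Vector.∷ rep T′ j
  injective : ∀ i j → r i ∼ r j → i ≡ j
  injective (inj₁ i) (inj₁ j) eq       = cong inj₁ (rep-injective T eq)
  injective (inj₁ i) (inj₂ j) (π , eq) =
    contradiction (sym (eq zero)) (proj₂ (rep-sound T i) (π ⟨$⟩ʳ zero))
  injective (inj₂ i) (inj₁ j) (π , eq) = contradiction
    (trans (eq (π ⟨$⟩ˡ zero)) (cong (r (inj₂ i)) (Perm.inverseʳ π)))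
    (proj₂ (rep-sound T j) (π ⟨$⟩ˡ zero))
  injective (inj₂ i) (inj₂ j) eq       = cong inj₂ (rep-injective T′ (∼-tail refl eq))
  ix : ∀ f → Φ f → ∃ λ i → f ∼ r i
  ix f p with Fin.any? (λ v → f v Fin.≟ zero)
  ... | no ¬z = let i , eq = index T (p , λ v z → ¬z (v , z)) in inj₁ i , eq
  -- `insert zero v ρ` sends `zero` to v and `suc w` to `punchIn v (ρ ⟨$⟩ʳ w)`, which brings v to
  -- the front.
  ... | yes (v , z) =
    let j , ρ , eq = index T′ (delete z p)
    in inj₂ j , insert zero v ρ , λ { zero → sym z ; (suc w) → eq w }

-- `shift` ends at one single-use color; on colorings that avoid `zero` this constrains nothing, so
-- it agrees with having none.
shift₀ : ∀ {n ℓ} → Transversal _∼_ (ProperK {n} {ℓ} 0) I →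
         Transversal _∼_ (λ f → ProperK {n} {suc ℓ} 0 f × Avoids₀ f) I
shift₀ T = transversal-cong {Φ = ProperAvoiding₀ 0} (mk⇔ id id)
  (mk⇔ (λ (_ , nz) → (λ _ _ → z≤n) , nz)
       (λ (_ , nz) → (λ {v} _ _ → ℕ.n≢0⇒n>0 (nz v ∘ Fin.toℕ-injective)) , nz))
  (shift ∼-suc⁻ ∼-suc⁺ T)

orbits-transversal : ∀ μ x n → Transversal _∼_ (ProperK {n} {μ ℕ.+ x} μ) (Fin (#orbits μ x n))
orbits-transversal zero x zero = record
  { rep           = λ _ ()
  ; rep-injective = λ { {zero} {zero} _ → refl }
  ; rep-sound     = λ _ _ _ → z≤n
  ; index         = λ _ → zero , Perm.id , λ ()
  }
orbits-transversal zero zero (suc n) = record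
  { rep           = λ ()
  ; rep-injective = λ { {()} }
  ; rep-sound     = λ ()
  ; index         = λ {f} _ → contradiction (f zero) Fin.¬Fin0
  }
orbits-transversal zero (suc x) (suc n) = reindex (↔-sym Fin.+↔⊎)
  (orbits-step {Φ = ProperK 0} {Ψ = ProperK 0} (λ _ _ _ → z≤n) (λ _ _ _ _ → z≤n)
    (shift₀ (orbits-transversal zero x (suc n))) (orbits-transversal zero (suc x) n))
orbits-transversal (suc μ) x zero = record
  { rep           = λ _ ()
  ; rep-injective = λ _ → rep-injective T (Perm.id , λ ())
  ; rep-sound     = λ _ {v} → ⊥-elim (Fin.¬Fin0 v)
  ; index         = λ _ → proj₁ (index T {λ ()} λ {v} → ⊥-elim (Fin.¬Fin0 v)) , Perm.id , λ ()
  }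
  where T = orbits-transversal μ x zero
orbits-transversal (suc μ) x (suc n) = reindex (↔-sym Fin.+↔⊎)
  (orbits-step (λ p → ProperK-punchIn⁺ {v = zero} refl p) (λ z p → ProperK-punchIn⁻ z p)
    (shift ∼-suc⁻ ∼-suc⁺ (orbits-transversal μ x (suc n)))
    (shift ∼-suc⁻ ∼-suc⁺ (orbits-transversal μ x n)))

OP-formula : ∀ {μ x ℓ} → μ ℕ.+ x ≡ ℓ → ∀ n → OP (K n) (Aut (K n)) ℓ μ ≡ #orbits μ x n
OP-formula {μ} {x} refl n = #classes-filter (equivalent-isDecEquivalence (K n) (Aut (K n))) (proper? (K n) μ)
  (λ {f} {g} eq → Equivalence.to (∼⇔Equivalent {f = f} {g}) (Perm.id , λ v → sym (eq v))) ≗-Proper colorings-complete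
  (transversal-cong (λ {f} {g} → ∼⇔Equivalent {f = f} {g}) ProperK⇔Proper (orbits-transversal μ x n))

-- Cycles of permutations

-- The cycle relation is generated by the single steps from i to π i.
sameCycle-lift : ∀ {A : Set} {R : Rel A 0ℓ} → IsEquivalence R → (π : Permutation′ n) (h : Fin n → A) →
  (∀ i → R (h i) (h (π ⟨$⟩ʳ i))) → ∀ {i j} → SameCycle π i j → R (h i) (h j)
sameCycle-lift {R = R} equiv π h step {i} (k , refl) = go k
  where
  open IsEquivalence equiv renaming (refl to R-refl; trans to R-trans)
  go : ∀ k → R (h i) (h (fold i (π ⟨$⟩ʳ_) k))
  go zero    = R-refl
  go (suc k) = R-trans (go k) (step _)

sameCycle-isEquivalence : (π : Permutation′ n) → IsEquivalence (SameCycle π)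
sameCycle-isEquivalence π = IsDecEquivalence.isEquivalence (sameCycle-isDecEquivalence π)

CycleTransversal : Permutation′ n → Set → Set
CycleTransversal π = Transversal (SameCycle π) (λ _ → ⊤)

cycles : (π : Permutation′ n) → CycleTransversal π (Fin (#cycles π))
cycles π = classes (sameCycle-isDecEquivalence π) (All.universal _ _)
  λ {i} _ → Any.map (λ { refl → 0 , refl }) (∈-allFin i)

#cycles-≡ : (π : Permutation′ n) → ∀ {k} → CycleTransversal π (Fin k) → #cycles π ≡ k
#cycles-≡ π = #classes-≡ (sameCycle-isDecEquivalence π) (All.universal _ _)
  λ {i} _ → Any.map (λ { refl → 0 , refl }) (∈-allFin i)

sameCycle-cong : {π ρ : Permutation′ n} → π ≈ ρ → ∀ {i j} → SameCycle π i j → SameCycle ρ i j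
sameCycle-cong {π = π} {ρ} eq = sameCycle-lift (sameCycle-isEquivalence ρ) π id λ i → 1 , sym (eq i)

#cycles-cong : {π ρ : Permutation′ n} → π ≈ ρ → #cycles π ≡ #cycles ρ
#cycles-cong {π = π} {ρ} eq = #cycles-≡ π
  (transversal-cong (mk⇔ (sameCycle-cong {π = ρ} {π} (sym ∘ eq)) (sameCycle-cong {π = π} {ρ} eq))
    (mk⇔ id id) (cycles ρ))

-- The transposition acts first: `suc j` goes to `zero`, and `zero` to `suc (ρ j)`, which splices
-- `zero` into the cycle of j.
insertAfter : Fin n → Permutation′ n → Permutation′ (suc n)
insertAfter j ρ = transpose zero (suc j) ∘ₚ lift₀ ρ

module _ (j : Fin n) (ρ : Permutation′ n) where

  private
    π = insertAfter j ρ
    module π = IsEquivalence (sameCycle-isEquivalence π)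
    module ρ = IsEquivalence (sameCycle-isEquivalence ρ)

  insertAfter-at : π ⟨$⟩ʳ suc j ≡ zero
  insertAfter-at rewrite dec-true (j Fin.≟ j) refl = refl

  insertAfter-≢ : ∀ {i} → i ≢ j → π ⟨$⟩ʳ suc i ≡ suc (ρ ⟨$⟩ʳ i)
  insertAfter-≢ {i} i≢j rewrite dec-false (i Fin.≟ j) i≢j = refl

  private
    j~0 : SameCycle π (suc j) zero
    j~0 = 1 , insertAfter-at

    extend : ∀ i → SameCycle π (suc i) (suc (ρ ⟨$⟩ʳ i))
    extend i with i Fin.≟ j
    ... | yes refl = π.trans j~0 (1 , refl)
    ... | no i≢j   = 1 , insertAfter-≢ i≢j

    -- Sending `zero` to its predecessor j turns each step of π into a step of ρ or into no move at
    -- all.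
    collapse : Fin (suc n) → Fin n
    collapse zero    = j
    collapse (suc i) = i

    collapse-step : ∀ i → SameCycle ρ (collapse i) (collapse (π ⟨$⟩ʳ i))
    collapse-step zero = 1 , refl
    collapse-step (suc i) with toSum (i Fin.≟ j)
    ... | inj₁ refl = subst (λ z → SameCycle ρ i (collapse z)) (sym insertAfter-at) ρ.refl
    ... | inj₂ i≢j  = 1 , cong collapse (sym (insertAfter-≢ i≢j))

  #cycles-insertAfter : #cycles π ≡ #cycles ρ
  #cycles-insertAfter = #cycles-≡ π record
    { rep           = suc ∘ rep T
    ; rep-injective = rep-injective T ∘
        sameCycle-lift (sameCycle-isEquivalence ρ) π collapse collapse-step
    ; rep-sound     = λ _ → tt
    ; index         = λ {i} _ → ix i
    }
    where
    T = cycles ρ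
    from-suc : ∀ i → ∃ λ c → SameCycle π (suc i) (suc (rep T c))
    from-suc i = map₂ (sameCycle-lift (sameCycle-isEquivalence π) ρ suc extend) (index T {i} tt)
    ix : ∀ i → ∃ λ c → SameCycle π i (suc (rep T c))
    ix zero    = map₂ (π.trans (π.sym j~0)) (from-suc j)
    ix (suc i) = from-suc i

insertAfter-cong : ∀ (j : Fin n) {ρ ρ′} → ρ ≈ ρ′ → insertAfter j ρ ≈ insertAfter j ρ′
insertAfter-cong j {ρ} {ρ′} eq i = Perm.lift₀-cong ρ ρ′ eq (transpose zero (suc j) ⟨$⟩ʳ i)

insertAfter-injective₁ : ∀ {j j′ : Fin n} {ρ ρ′} → insertAfter j ρ ≈ insertAfter j′ ρ′ → j ≡ j′
insertAfter-injective₁ {j = j} {j′} {ρ} {ρ′} eq = Fin.suc-injective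
  (Injection.injective (↔⇒↣ (insertAfter j′ ρ′))
    (trans (sym (eq (suc j))) (trans (insertAfter-at j ρ) (sym (insertAfter-at j′ ρ′)))))

insertAfter-injective₂ : ∀ {j : Fin n} {ρ ρ′} → insertAfter j ρ ≈ insertAfter j ρ′ → ρ ≈ ρ′
insertAfter-injective₂ {j = j} {ρ} {ρ′} eq i with i Fin.≟ j
... | yes refl = Fin.suc-injective (eq zero)
... | no i≢j   = Fin.suc-injective
  (trans (sym (insertAfter-≢ j ρ i≢j)) (trans (eq (suc i)) (insertAfter-≢ j ρ′ i≢j)))

insertAfter-surjective : (π : Permutation′ (suc n)) → π ⟨$⟩ʳ zero ≢ zero →
                         ∃ λ j → ∃ λ ρ → π ≈ insertAfter j ρ
insertAfter-surjective π π0≢0 with π ⟨$⟩ˡ zero in eq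
... | zero  = contradiction (trans (cong (π ⟨$⟩ʳ_) (sym eq)) (Perm.inverseʳ π)) π0≢0
-- The predecessor of `zero` is its preimage, nonzero since `zero` is moved; swapping the two before
-- π makes σ fix `zero`.
... | suc j = j , remove zero σ , λ i → sym (trans
  (Perm.lift₀-remove σ (trans (cong (π ⟨$⟩ʳ_) (sym eq)) (Perm.inverseʳ π)) (PC.transpose zero (suc j) i))
  (cong (π ⟨$⟩ʳ_) (PC.transpose-inverse (suc j) zero)))
  where σ = transpose (suc j) zero ∘ₚ π

insertFixed : Fin (suc n) → Permutation′ n → Permutation′ (suc n)
insertFixed j = insert j j

insertFixed-at : ∀ (j : Fin (suc n)) τ → insertFixed j τ ⟨$⟩ʳ j ≡ j
insertFixed-at j τ with j Fin.≟ j
... | yes _  = refl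
... | no j≢j = contradiction refl j≢j

insertFixed-punchIn : ∀ (j : Fin (suc n)) τ i → insertFixed j τ ⟨$⟩ʳ punchIn j i ≡ punchIn j (τ ⟨$⟩ʳ i)
insertFixed-punchIn j = Perm.insert-punchIn j j

insertFixed-cong : ∀ (j : Fin (suc n)) {τ τ′} → τ ≈ τ′ → insertFixed j τ ≈ insertFixed j τ′
insertFixed-cong j {τ} {τ′} eq i with punchView j i
... | inj₁ refl       = trans (insertFixed-at j τ) (sym (insertFixed-at j τ′))
... | inj₂ (k , refl) = trans (insertFixed-punchIn j τ k)
  (trans (cong (punchIn j) (eq k)) (sym (insertFixed-punchIn j τ′ k)))

insertFixed-injective : ∀ {j : Fin (suc n)} {τ τ′} → insertFixed j τ ≈ insertFixed j τ′ → τ ≈ τ′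
insertFixed-injective {j = j} {τ} {τ′} eq i = Fin.punchIn-injective j _ _
  (trans (sym (insertFixed-punchIn j τ i)) (trans (eq (punchIn j i)) (insertFixed-punchIn j τ′ i)))

insertFixed-surjective : ∀ (ρ : Permutation′ (suc n)) {j} → ρ ⟨$⟩ʳ j ≡ j →
                         ρ ≈ insertFixed j (remove j ρ)
insertFixed-surjective ρ {j} eq i =
  sym (subst (λ z → insert j z (remove j ρ) ≈ ρ) eq (Perm.insert-remove j ρ) i)

-- j is a cycle by itself, and `punchIn j` carries iterates of τ to iterates of the extension.
#cycles-insertFixed : ∀ (j : Fin (suc n)) τ → #cycles (insertFixed j τ) ≡ suc (#cycles τ)
#cycles-insertFixed {n} j τ = #cycles-≡ ρ record
  { rep           = r
  ; rep-injective = λ {a} {b} → injective a b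
  ; rep-sound     = λ _ → tt
  ; index         = λ {i} _ → ix i
  }
  where
  ρ = insertFixed j τ
  T = cycles τ
  r : Fin (suc (#cycles τ)) → Fin (suc n)
  r zero    = j
  r (suc c) = punchIn j (rep T c)
  iterate-at : ∀ k → fold j (ρ ⟨$⟩ʳ_) k ≡ j
  iterate-at zero    = refl
  iterate-at (suc k) = trans (cong (ρ ⟨$⟩ʳ_) (iterate-at k)) (insertFixed-at j τ)
  iterate-punchIn : ∀ i k → fold (punchIn j i) (ρ ⟨$⟩ʳ_) k ≡ punchIn j (fold i (τ ⟨$⟩ʳ_) k)
  iterate-punchIn i zero    = refl
  iterate-punchIn i (suc k) = trans (cong (ρ ⟨$⟩ʳ_) (iterate-punchIn i k)) (insertFixed-punchIn j τ _)
  injective : ∀ a b → SameCycle ρ (r a) (r b) → a ≡ b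
  injective zero    zero    _        = refl
  injective zero    (suc b) (k , eq) = contradiction (trans (sym eq) (iterate-at k)) (Fin.punchInᵢ≢i j _)
  injective (suc a) zero    (k , eq) =
    contradiction (trans (sym (iterate-punchIn _ k)) eq) (Fin.punchInᵢ≢i j _)
  injective (suc a) (suc b) (k , eq) = cong suc (rep-injective T
    (k , Fin.punchIn-injective j _ _ (trans (sym (iterate-punchIn _ k)) eq)))
  ix : ∀ i → ∃ λ c → SameCycle ρ i (r c)
  ix i with punchView j i
  ... | inj₁ refl       = zero , 0 , refl
  ... | inj₂ (i′ , refl) = let c , k , eq = index T {i′} tt in
    suc c , k , trans (iterate-punchIn i′ k) (cong (punchIn j) eq)

-- Derangements

Derangement : ∀ {n} → ℕ → Pred (Permutation′ n) 0ℓ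
Derangement k π = #cycles π ≡ k × ∀ i → π ⟨$⟩ʳ i ≢ i

derangement-cong : ∀ {k} {π ρ : Permutation′ n} → π ≈ ρ → Derangement k π → Derangement k ρ
derangement-cong {π = π} {ρ} eq (c , d) =
  trans (sym (#cycles-cong {π = π} {ρ} eq)) c , λ i fix → d i (trans (eq i) fix)

-- ρ may fix j, because `zero` and `suc j` then form a 2-cycle.
insertAfter-≢id : ∀ (j : Fin n) ρ → (∀ i → i ≢ j → ρ ⟨$⟩ʳ i ≢ i) → ∀ i → insertAfter j ρ ⟨$⟩ʳ i ≢ i
insertAfter-≢id j ρ d zero    ()
insertAfter-≢id j ρ d (suc i) eq with toSum (i Fin.≟ j)
... | inj₁ refl = contradiction (trans (sym (insertAfter-at j ρ)) eq) λ ()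
... | inj₂ i≢j  = d i i≢j (Fin.suc-injective (trans (sym (insertAfter-≢ j ρ i≢j)) eq))

-- Removing zero from its cycle leaves a derangement, unless that cycle was a
-- 2-cycle; then its other element becomes a fixed point, and is removed as well.
derangements-step : ∀ {m k} →
  Transversal _≈_ (Derangement {suc m} (suc k)) I → Transversal _≈_ (Derangement {m} k) J →
  Transversal _≈_ (Derangement {suc (suc m)} (suc k)) (Fin (suc m) × I ⊎ Fin (suc m) × J)
derangements-step {I} {J} {m} {k} T T′ = record
  { rep           = λ a → insertAfter (pos a) (ext a)
  ; rep-injective = λ {a} {b} → injective a b
  ; rep-sound     = sound
  ; index         = λ {π} → ix π
  }
  where
  pos : Fin (suc m) × I ⊎ Fin (suc m) × J → Fin (suc m)
  pos (inj₁ (j , _)) = j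
  pos (inj₂ (j , _)) = j
  ext : Fin (suc m) × I ⊎ Fin (suc m) × J → Permutation′ (suc m)
  ext (inj₁ (j , i)) = rep T i
  ext (inj₂ (j , i)) = insertFixed j (rep T′ i)

  ext-injective : ∀ a b → pos a ≡ pos b → ext a ≈ ext b → a ≡ b
  ext-injective (inj₁ (j , a)) (inj₁ (j , b)) refl eq = cong (λ z → inj₁ (j , z)) (rep-injective T eq)
  -- The two kinds differ at j: `insertFixed j` fixes it, a derangement does not.
  ext-injective (inj₁ (j , a)) (inj₂ (j , b)) refl eq =
    contradiction (trans (eq j) (insertFixed-at j (rep T′ b))) (proj₂ (rep-sound T a) j)
  ext-injective (inj₂ (j , a)) (inj₁ (j , b)) refl eq =
    contradiction (trans (sym (eq j)) (insertFixed-at j (rep T′ a))) (proj₂ (rep-sound T b) j)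
  ext-injective (inj₂ (j , a)) (inj₂ (j , b)) refl eq = cong (λ z → inj₂ (j , z))
    (rep-injective T′ (insertFixed-injective {j = j} {rep T′ a} {rep T′ b} eq))

  injective : ∀ a b → insertAfter (pos a) (ext a) ≈ insertAfter (pos b) (ext b) → a ≡ b
  injective a b eq = ext-injective a b p (insertAfter-injective₂ {j = pos a} {ext a} {ext b}
    (subst (λ j → insertAfter (pos a) (ext a) ≈ insertAfter j (ext b)) (sym p) eq))
    where p = insertAfter-injective₁ {j = pos a} {pos b} {ext a} {ext b} eq

  sound : ∀ a → Derangement (suc k) (insertAfter (pos a) (ext a))
  sound (inj₁ (j , a)) =
      trans (#cycles-insertAfter j ρ) (proj₁ (rep-sound T a))
    , insertAfter-≢id j ρ (λ i _ → proj₂ (rep-sound T a) i)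
    where ρ = rep T a
  sound (inj₂ (j , a)) =
      trans (#cycles-insertAfter j (insertFixed j τ))
        (trans (#cycles-insertFixed j τ) (cong suc (proj₁ (rep-sound T′ a))))
    , insertAfter-≢id j (insertFixed j τ) moved
    where
    τ = rep T′ a
    moved : ∀ i → i ≢ j → insertFixed j τ ⟨$⟩ʳ i ≢ i
    moved i i≢j eq with punchView j i
    ... | inj₁ refl       = i≢j refl
    ... | inj₂ (u , refl) = proj₂ (rep-sound T′ a) u
      (Fin.punchIn-injective j _ _ (trans (sym (insertFixed-punchIn j τ u)) eq))

  ix : ∀ π → Derangement (suc k) π → ∃ λ a → π ≈ insertAfter (pos a) (ext a)
  ix π (c , d) with insertAfter-surjective π (d zero)
  ... | j , ρ , π≈ with ρ ⟨$⟩ʳ j Fin.≟ j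
  ...   | no ρj≢j =
    let a , eq = index T (cρ , dρ)
    in inj₁ (j , a) , λ i → trans (π≈ i) (insertAfter-cong j {ρ} {rep T a} eq i)
    where
    cρ : #cycles ρ ≡ suc k
    cρ = trans (sym (#cycles-insertAfter j ρ))
           (trans (sym (#cycles-cong {π = π} {insertAfter j ρ} π≈)) c)
    dρ : ∀ i → ρ ⟨$⟩ʳ i ≢ i
    dρ i eq with i Fin.≟ j
    ... | yes refl = ρj≢j eq
    ... | no i≢j   = d (suc i) (trans (π≈ (suc i)) (trans (insertAfter-≢ j ρ i≢j) (cong suc eq)))
  ...   | yes ρj≡j =
    let a , eq = index T′ (cτ , dτ)
    in inj₂ (j , a) , λ i → trans (π≈ i) (insertAfter-cong j {ρ} {insertFixed j (rep T′ a)}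
         (λ u → trans (ρ≈ u) (insertFixed-cong j {τ} {rep T′ a} eq u)) i)
    where
    τ = remove j ρ
    ρ≈ : ρ ≈ insertFixed j τ
    ρ≈ = insertFixed-surjective ρ ρj≡j
    cτ : #cycles τ ≡ k
    cτ = ℕ.suc-injective (trans (sym (#cycles-insertFixed j τ))
      (trans (sym (#cycles-cong {π = ρ} {insertFixed j τ} ρ≈))
        (trans (sym (#cycles-insertAfter j ρ))
          (trans (sym (#cycles-cong {π = π} {insertAfter j ρ} π≈)) c))))
    dτ : ∀ i → τ ⟨$⟩ʳ i ≢ i
    dτ i eq = d (suc (punchIn j i)) (trans (π≈ (suc (punchIn j i)))
      (trans (insertAfter-≢ j ρ (Fin.punchInᵢ≢i j i))
        (cong suc (trans (ρ≈ (punchIn j i)) (trans (insertFixed-punchIn j τ i) (cong (punchIn j) eq))))))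

derangements-transversal : ∀ m k → Transversal _≈_ (Derangement {m} k) (Fin (#derangements m k))
derangements-transversal zero zero = record
  { rep           = λ _ → Perm.id
  ; rep-injective = λ { {zero} {zero} _ → refl }
  ; rep-sound     = λ _ → refl , λ ()
  ; index         = λ _ → zero , λ ()
  }
derangements-transversal zero (suc k) = record
  { rep           = λ ()
  ; rep-injective = λ { {()} }
  ; rep-sound     = λ ()
  ; index         = λ { (() , _) }
  }
derangements-transversal (suc m) zero = record
  { rep           = λ ()
  ; rep-injective = λ { {()} }
  ; rep-sound     = λ ()
  ; index         = λ {π} (c , _) → contradiction (subst Fin c (proj₁ (index (cycles π) {zero} tt))) Fin.¬Fin0
  }
derangements-transversal (suc zero) (suc k) = record
  { rep           = λ ()
  ; rep-injective = λ { {()} }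
  ; rep-sound     = λ ()
  ; index         = λ {π} (_ , d) → contradiction (only (π ⟨$⟩ʳ zero)) (d zero)
  }
  where
  only : (i : Fin 1) → i ≡ zero
  only zero = refl
derangements-transversal (suc (suc m)) (suc k) =
  reindex (↔-sym ((Fin.*↔× ⊎-↔ Fin.*↔×) ↔-∘ Fin.+↔⊎))
    (derangements-step (derangements-transversal (suc m) (suc k)) (derangements-transversal m k))

-- Cycle lengths and fixed points

module _ (π : Permutation′ n) (i : Fin n) where

  private
    cycle : List (Fin n)
    cycle = filter (IsDecEquivalence._≟_ (sameCycle-isDecEquivalence π) i) (allFin n)

    cycle⁺ : ∀ {j} → SameCycle π i j → j ∈ cycle
    cycle⁺ = ∈-filter⁺ (IsDecEquivalence._≟_ (sameCycle-isDecEquivalence π) i) (∈-allFin _)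

    cycle⁻ : ∀ {j} → j ∈ cycle → SameCycle π i j
    cycle⁻ = proj₂ ∘ ∈-filter⁻ (IsDecEquivalence._≟_ (sameCycle-isDecEquivalence π) i) {xs = allFin n}

  -- The cycle of a fixed point fits into a one-element list; that of a moved point contains the
  -- distinct elements i and π i.
  2≤cycleLength⇔≢ : 2 ≤ cycleLength π i ⇔ (π ⟨$⟩ʳ i ≢ i)
  2≤cycleLength⇔≢ = mk⇔
    (λ 2≤ fix → contradiction (ℕ.≤-trans 2≤ (unique-⊆⇒length≤ {ys = i ∷ []}
      (Unique.filter⁺ _ (Unique.allFin⁺ n)) λ j∈ → fixed fix (cycle⁻ j∈))) λ { (s≤s ()) })
    (λ moved → unique-⊆⇒length≤ {xs = i ∷ (π ⟨$⟩ʳ i) ∷ []} ((≢-sym moved ∷ []) ∷ [] ∷ [])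
      λ { (here refl) → cycle⁺ (0 , refl) ; (there (here refl)) → cycle⁺ (1 , refl) })
    where
    fixed : π ⟨$⟩ʳ i ≡ i → ∀ {j} → SameCycle π i j → j ∈ i ∷ []
    fixed fix (k , refl) = here (go k)
      where
      go : ∀ k → fold i (π ⟨$⟩ʳ_) k ≡ i
      go zero    = refl
      go (suc k) = trans (cong (π ⟨$⟩ʳ_) (go k)) fix

associated⇔derangement : ∀ {k} {π : Permutation′ n} → AssociatedCycles 2 k π ⇔ Derangement k π
associated⇔derangement {π = π} = mk⇔
  (λ (c , l) → c , λ i → Equivalence.to (2≤cycleLength⇔≢ π i) (l i))
  (λ (c , d) → c , λ i → Equivalence.from (2≤cycleLength⇔≢ π i) (d i))

associatedStirling₁-formula : ∀ m k → associatedStirling₁ 2 m k ≡ #derangements m k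
associatedStirling₁-formula m k = #classes-filter ≈-isDecEquivalence (associatedCycles? 2 k)
  id
  (λ {π} {ρ} eq → Equivalence.from (associated⇔derangement {π = ρ}) ∘ derangement-cong {π = π} {ρ} eq
                    ∘ Equivalence.to (associated⇔derangement {π = π}))
  permutations-complete
  (transversal-cong (mk⇔ id id) (λ {π} → mk⇔ (Equivalence.from (associated⇔derangement {π = π}))
                                              (Equivalence.to (associated⇔derangement {π = π})))
    (derangements-transversal m k))

-- The binomial formulas for OP and P

eval-Q : ∀ x m → eval (Q m) x ≡ derangementPoly x m
eval-Q x m = trans (eval-map-applyUpTo (λ k → + associatedStirling₁ 2 m k) x m id)
  (sumTo-cong m λ k _ → cong (λ s → + s * x ^ k) (associatedStirling₁-formula m k))

pos-∸ : ∀ μ x {ℓ} → μ ℕ.+ x ≡ ℓ → + ℓ - + μ ≡ + x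
pos-∸ μ x refl = cancel (+ μ) (+ x)
  where
  cancel : ∀ a b → a + b - a ≡ b
  cancel = solve-∀

n!OP-formula : ∀ n {ℓ} μ x → μ ℕ.+ x ≡ ℓ →
  sumTo n (λ m → + (n C m) * eval (Q m) (+ ℓ - + μ) * + P (K (n ∸ m)) ℓ μ)
    ≡ + (n !) * + OP (K n) (Aut (K n)) ℓ μ
n!OP-formula n {ℓ} μ x eq = begin
  sumTo n (λ m → + (n C m) * eval (Q m) (+ ℓ - + μ) * + P (K (n ∸ m)) ℓ μ)
    ≡⟨ sumTo-cong n (λ m _ → cong₂ (λ u v → + (n C m) * u * + v)
         (trans (cong (eval (Q m)) (pos-∸ μ x eq)) (eval-Q (+ x) m)) (P-formula eq (n ∸ m))) ⟩
  sumTo n (λ m → + (n C m) * q m * + #proper μ x (n ∸ m))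
    ≡⟨ binomialSum n q (λ k → + #proper μ x k) ⟩
  (q ⊛ (λ k → + #proper μ x k)) n
    ≡⟨ n!#orbits-formula q μ x (⊛-^≡^↑ (+ x) q refl (derangementPoly-rec (+ x))) n ⟨
  + (n ! ℕ.* #orbits μ x n)
    ≡⟨ ℤ.pos-* (n !) (#orbits μ x n) ⟩
  + (n !) * + #orbits μ x n
    ≡⟨ cong (λ k → + (n !) * + k) (OP-formula eq n) ⟨
  + (n !) * + OP (K n) (Aut (K n)) ℓ μ ∎
  where
  q : Sequence
  q = derangementPoly (+ x)

P-binomial : ∀ r {ℓ} μ x → μ ℕ.+ x ≡ ℓ →
  + P (K r) ℓ μ ≡ sumTo r (λ k → + (r C k) * (+ ℓ - + μ) ^ k * ((+ μ) ^↓ (r ∸ k)))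
P-binomial r {ℓ} μ x eq = begin
  + P (K r) ℓ μ
    ≡⟨ cong +_ (P-formula eq r) ⟩
  + #proper μ x r
    ≡⟨ #proper-formula μ x r ⟩
  (((+ x) ^_) ⊛ ((+ μ) ^↓_)) r
    ≡⟨ binomialSum r ((+ x) ^_) ((+ μ) ^↓_) ⟨
  sumTo r (λ k → + (r C k) * (+ x) ^ k * ((+ μ) ^↓ (r ∸ k)))
    ≡⟨ cong (λ y → sumTo r (λ k → + (r C k) * y ^ k * ((+ μ) ^↓ (r ∸ k)))) (pos-∸ μ x eq) ⟨
  sumTo r (λ k → + (r C k) * (+ ℓ - + μ) ^ k * ((+ μ) ^↓ (r ∸ k))) ∎

theorem6 : ∀ (n ℓ μ : ℕ) .{{_ : NonZero n}} .{{_ : NonZero ℓ}} → μ ≤ ℓ →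
  ((+ OP (K n) (Aut (K n)) ℓ μ) / 1
    ≡ _/_ (sumTo n (λ m → + (n C m) * eval (Q m) (+ ℓ - + μ) * + P (K (n ∸ m)) ℓ μ)) (n !) {{n !≢0}})
  × (∀ m → m ≤ n →
      + P (K (n ∸ m)) ℓ μ
        ≡ sumTo (n ∸ m) (λ k → + ((n ∸ m) C k) * (+ ℓ - + μ) ^ k * ((+ μ) ^↓ ((n ∸ m) ∸ k))))
theorem6 n ℓ μ μ≤ℓ =
    /-cancel (n !) {{n !≢0}} (+ OP (K n) (Aut (K n)) ℓ μ) (n!OP-formula n μ (ℓ ∸ μ) μ+[ℓ∸μ]≡ℓ)
  , λ m _ → P-binomial (n ∸ m) μ (ℓ ∸ μ) μ+[ℓ∸μ]≡ℓ
  where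
  -- Here μ ≤ ℓ enters: it makes truncated subtraction exact, so that x = `ℓ ∸ μ` represents λ - μ.
  μ+[ℓ∸μ]≡ℓ : μ ℕ.+ (ℓ ∸ μ) ≡ ℓ
  μ+[ℓ∸μ]≡ℓ = ℕ.m+[n∸m]≡n μ≤ℓ
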